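{- For the Tseitin contradiction $T_n$ on the $n\times n$ toroidal rectangular grid ($n$ odd), $$S_{3\text{ -SRC-II}}(T_n)=\mathcal{O}(n^2).$$
   Context: Let $G=\langle V,E\rangle$ be a graph and $\alpha:V\to\mathbb{F}_2$ with $\sum_{v}\alpha(v)=1$. The Tseitin formula on $G$ with charge $\alpha$ has variables $x_e$, $e\in E$, and encodes for every $v\in V$ the equation $\sum_{e\ni v}x_e=\alpha(v)\pmod 2$ by the $2^{\deg(v)-1}$ clauses of width $\deg(v)$ excluding the assignments to $\{x_e: e\ni v\}$ that violate the equation. It is a Tseitin contradiction if $|V|$ is odd and $\alpha(v)=1$ for all $v$. $T_n$ ($n$ odd, $n\ge 3$) is the Tseitin contradiction on the toroidal rectangular grid of size $n\times n$: vertices $(i,j)\in(\mathbb{Z}/n)^2$, edges joining $(i,j)$ to $(i+1,j)$ and to $(i,j+1)$. A clause is a disjunction (set) of literals. For $k\ge1$, a $k$-symmetry is a bijection $\phi$ of literals onto literals with $\phi(\lnot x)=\lnot\phi(x)$ and $\phi(x)=x$ for all variables $x$ except at most $k$ of them; it acts on clauses literal by literal. A $k$-SRC-II proof (Resolution with local $k$-symmetries) of an unsatisfiable CNF is a sequence of clauses ending with the empty clause, each of which is an input clause, or is obtained from earlier clauses by the resolution rule (from $A\lor x$ and $B\lor\lnot x$ infer $A\lor B$), or is obtained by the symmetry rule: if a clause $A$ was inferred earlier in the proof from $B_1,\dots,B_l$, and $\phi$ is a $k$-symmetry such that all $B_i$ and all $\phi(B_i)$ are input clauses, infer $\phi(A)$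 in one step. There is no weakening rule. $S_\Pi(\Phi)$ is the number of steps in the shortest proof of $\Phi$ in $\Pi$. -}

module Defs where

open import Data.Fin.Base using (Fin; toℕ)
import Data.Fin.Properties as Fin
open import Data.List.Base
  using (List; []; _∷_; [_]; _++_; map; concatMap; filter; foldr; length;
         allFin; cartesianProduct; cartesianProductWith)
open import Data.List.Membership.Propositional using (_∈_; _∉_)
open import Data.List.Membership.Propositional.Properties
  using (∈-allFin; ∈-cartesianProduct⁺)
open import Data.List.Relation.Binary.BagAndSetEquality using (_∼[_]_; set)
open import Data.List.Relation.Unary.All using (All; []; _∷_)
open import Data.List.Relation.Unary.AllPairs using ([]; _∷_)
open import Data.List.Relation.Unary.Any using (Any; here; there)
open import Data.List.Relation.Unary.Unique.Propositional using (Unique)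
open import Data.List.Relation.Unary.Unique.Propositional.Properties
  using (allFin⁺; cartesianProduct⁺)
open import Data.Nat.Base using (ℕ; suc; _≤_)
open import Data.Nat.DivMod using (_mod_)
open import Data.Parity.Base using (Parity; 0ℙ; 1ℙ; _+_)
open import Data.Parity.Properties using (_≟_)
open import Data.Product.Base using (_×_; _,_; proj₁; proj₂; ∃-syntax)
open import Data.Product.Properties using (≡-dec)
open import Data.Sum.Base using (_⊎_)
open import Function.Bundles using (_↔_; Inverse)
open import Relation.Binary.Definitions using (DecidableEquality)
open import Relation.Binary.PropositionalEquality.Core using (_≡_; refl)
open import Relation.Nullary.Decidable using (Dec; ¬?; _⊎-dec_)

data Literal (X : Set) : Set where
  pos neg : X → Literal X

¬ˡ_ : {X : Set} → Literal X → Literal X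
¬ˡ pos x = neg x
¬ˡ neg x = pos x

-- A clause is a set of literals: lists are only ever compared through _≈_.
Clause : Set → Set
Clause X = List (Literal X)

infix 4 _≈_
_≈_ : {X : Set} → Clause X → Clause X → Set
A ≈ B = A ∼[ set ] B

CNF : Set → Set
CNF X = List (Clause X)

IsInput : {X : Set} → CNF X → Clause X → Set
IsInput Φ A = Any (A ≈_) Φ

record Symmetry (X : Set) (k : ℕ) : Set where
  field
    bijection : Literal X ↔ Literal X

  open Inverse bijection public using (to; from)

  field
    respects-¬ : ∀ l → to (¬ˡ l) ≡ ¬ˡ (to l)
    support    : List X
    local      : length support ≤ k
    fixes      : ∀ x → x ∉ support → to (pos x) ≡ pos x

infixr 8 _·_
_·_ : {X : Set} {k : ℕ} → Symmetry X k → Clause X → Clause X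
φ · A = map (Symmetry.to φ) A

-- A line  A from Bs  of a proof: the clause A, together with the input clauses
-- Bs from which it was inferred.
infix 4 _from_
record Line (X : Set) : Set where
  constructor _from_
  field
    clause  : Clause X
    sources : List (Clause X)

-- Step k Φ Γ ℓ: the line ℓ follows in one step from the earlier lines Γ.
data Step {X : Set} (k : ℕ) (Φ : CNF X) (Γ : List (Line X)) : Line X → Set where

  input : ∀ {A} → IsInput Φ A → Step k Φ Γ (A from [ A ])

  -- Since clauses are sets, A ∨ x is the clause A itself when x already occurs
  -- in A; the side conditions ensure that the resolved literals are removed and
  -- so exclude a hidden weakening.
  resolve : ∀ {C D R A B x Cs Ds} →
            (C from Cs) ∈ Γ → C ≈ pos x ∷ A → pos x ∉ A →
            (D from Ds) ∈ Γ → D ≈ neg x ∷ B → neg x ∉ B →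
            R ≈ A ++ B →
            Step k Φ Γ (R from Cs ++ Ds)

  -- Applying φ throughout the inference of A from Bs gives an inference of φ · A
  -- from the clauses φ · B, so these are the sources of the new line.
  symmetry : ∀ {A R Bs} →
             (A from Bs) ∈ Γ → (φ : Symmetry X k) →
             All (IsInput Φ) Bs → All (λ B → IsInput Φ (φ · B)) Bs →
             R ≈ φ · A →
             Step k Φ Γ (R from map (φ ·_) Bs)

-- The most recent line is at the head of the list.
data Proof {X : Set} (k : ℕ) (Φ : CNF X) : List (Line X) → Set where
  []  : Proof k Φ []
  _∷_ : ∀ {Γ ℓ} → Step k Φ Γ ℓ → Proof k Φ Γ → Proof k Φ (ℓ ∷ Γ)

HasRefutation : {X : Set} → ℕ → CNF X → ℕ → Set
HasRefutation k Φ s =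
  ∃[ Bs ] ∃[ Γ ] (Proof k Φ (([] from Bs) ∷ Γ) × length (([] from Bs) ∷ Γ) ≡ s)

-- S[ k -SRC-II] Φ ≔ s: the shortest k-SRC-II proof of Φ has s steps.
infix 4 S[_-SRC-II]_≔_
S[_-SRC-II]_≔_ : {X : Set} → ℕ → CNF X → ℕ → Set
S[ k -SRC-II] Φ ≔ s = HasRefutation k Φ s × (∀ t → HasRefutation k Φ t → s ≤ t)

-- Loops and parallel edges are not excluded here; torus n has none once 3 ≤ n.
record Graph : Set₁ where
  field
    Vertex Edge       : Set
    _≟ᵛ_              : DecidableEquality Vertex
    vertices          : List Vertex
    vertices-complete : ∀ v → v ∈ vertices
    vertices-unique   : Unique vertices
    edges             : List Edge
    edges-complete    : ∀ e → e ∈ edges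
    edges-unique      : Unique edges
    endpoints         : Edge → Vertex × Vertex

  _∋ᵛ_ : Edge → Vertex → Set
  e ∋ᵛ v = proj₁ (endpoints e) ≡ v ⊎ proj₂ (endpoints e) ≡ v

  _∋ᵛ?_ : ∀ e v → Dec (e ∋ᵛ v)
  e ∋ᵛ? v = (proj₁ (endpoints e) ≟ᵛ v) ⊎-dec (proj₂ (endpoints e) ≟ᵛ v)

  incident : Vertex → List Edge
  incident v = filter (_∋ᵛ? v) edges

Assignment : Set → Set
Assignment X = List (X × Parity)

assignments : {X : Set} → List X → List (Assignment X)
assignments []       = [ [] ]
assignments (x ∷ xs) =
  cartesianProductWith _∷_ ((x , 0ℙ) ∷ (x , 1ℙ) ∷ []) (assignments xs)

total : {X : Set} → Assignment X → Parity
total = foldr (λ xb s → proj₂ xb + s) 0ℙ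

falsified : {X : Set} → X × Parity → Literal X
falsified (x , 0ℙ) = pos x
falsified (x , 1ℙ) = neg x

excluding : {X : Set} → Assignment X → Clause X
excluding = map falsified

module _ (G : Graph) where
  open Graph G

  violating : (Vertex → Parity) → Vertex → List (Assignment Edge)
  violating α v = filter (λ a → ¬? (total a ≟ α v)) (assignments (incident v))

  tseitin : (Vertex → Parity) → CNF Edge
  tseitin α = concatMap (λ v → map excluding (violating α v)) vertices

next : {n : ℕ} → Fin n → Fin n
next {suc m} i = suc (toℕ i) mod suc m

data Direction : Set where
  i-step j-step : Direction

GridVertex GridEdge : ℕ → Set
GridVertex n = Fin n × Fin n
GridEdge   n = GridVertex n × Direction

torus : ℕ → Graph
torus n = record
  { Vertex            = GridVertex n
  ; Edge              = GridEdge n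
  ; _≟ᵛ_              = ≡-dec Fin._≟_ Fin._≟_
  ; vertices          = grid
  ; vertices-complete = grid-complete
  ; vertices-unique   = grid-unique
  ; edges             = cartesianProduct grid directions
  ; edges-complete    = λ (v , d) → ∈-cartesianProduct⁺ (grid-complete v) (directions-complete d)
  ; edges-unique      = cartesianProduct⁺ grid-unique (((λ ()) ∷ []) ∷ [] ∷ [])
  ; endpoints         = ends
  }
  where
  grid : List (GridVertex n)
  grid = cartesianProduct (allFin n) (allFin n)

  grid-complete : ∀ v → v ∈ grid
  grid-complete (i , j) = ∈-cartesianProduct⁺ (∈-allFin i) (∈-allFin j)

  grid-unique : Unique grid
  grid-unique = cartesianProduct⁺ (allFin⁺ n) (allFin⁺ n)

  directions : List Direction
  directions = i-step ∷ j-step ∷ []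

  directions-complete : ∀ d → d ∈ directions
  directions-complete i-step = here refl
  directions-complete j-step = there (here refl)

  ends : GridEdge n → GridVertex n × GridVertex n
  ends ((i , j) , i-step) = (i , j) , (next i , j)
  ends ((i , j) , j-step) = (i , j) , (i , next j)

T : (n : ℕ) → CNF (GridEdge n)
T n = tseitin (torus n) (λ _ → 1ℙ)

{-# OPTIONS --safe #-}

-- Sweep the torus row by row and derive clauses on the boundary edges of the set S of vertices swept so far. Of the
-- sum of the equations in S, only the clauses whose literals are positive outside a bounded set I of boundary edges
-- are kept. To add a vertex v, all shared edges must lie in I; each clause then results from O(1) resolutions.
-- Flipping the three edges of a path whose inner vertices lie in S and whose ends do not preserves every equation
-- in S, so a 3-symmetry trades one boundary edge of I for a neighbouring one. The next vertex closes a 4-cycle with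
-- the one above it and the one to its left, which is too long for a flip; this is why I carries the edge to the left
-- along, together with one edge for each of the two directions in which the torus closes up.
-- That a shortest proof exists is a finite search: up to the equality of clauses as sets and the choice of the
-- sources, there are only finitely many lines that can follow a given list of lines.

module Submission where

open import Defs
open import Data.Nat.Base using (ℕ; zero; suc; _+_; _*_; _^_; _%_; _≤_; _<_; z≤n; s≤s; parity)
open import Data.Product.Base using (_×_; _,_; proj₁; proj₂; ∃-syntax)
open import Relation.Binary.PropositionalEquality using (_≡_; _≢_; _≗_; refl; sym; trans; cong; cong₂; subst)

import Data.Parity.Properties as ℙ
open import Algebra.Properties.CommutativeSemigroup ℙ.+-commutativeSemigroup using (interchange)
open import Data.Empty using (⊥)
open import Data.Fin.Base using (Fin; zero; suc; toℕ; fromℕ; inject₁)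
open import Data.Fin.Induction using (<-weakInduction)
import Data.Fin.Properties as Fin
open import Data.Fin.Relation.Unary.Top using (view; ‵fromℕ; ‵inject₁)
open import Data.List.Base using (List; []; _∷_; [_]; _++_; map; length; filter; foldr; cartesianProductWith)
import Data.List.Membership.DecPropositional as DecMembership
open import Data.List.Membership.Propositional using (_∈_; _∉_; find; lose)
open import Data.List.Membership.Propositional.Properties
  using (∈-map⁺; ∈-map⁻; ∈-++⁺ˡ; ∈-++⁺ʳ; ∈-++⁻; ∈-concatMap⁺; ∈-cartesianProductWith⁺; ∈-filter⁺; ∈-filter⁻)
open import Data.List.Properties using (≡-dec; map-cong; map-id; map-∘; length-map; length-++; length-filter)
import Data.List.Relation.Binary.BagAndSetEquality as Set
open import Data.List.Relation.Binary.Pointwise.Base using (Pointwise; []; _∷_)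
open import Data.List.Relation.Binary.Subset.Propositional using (_⊆_)
open import Data.List.Relation.Unary.All as All using (All; []; _∷_; all?)
import Data.List.Relation.Unary.All.Properties as All
open import Data.List.Relation.Unary.AllPairs using (_∷_)
open import Data.List.Relation.Unary.Any as Any using (Any; here; there; any?)
import Data.List.Relation.Unary.Any.Properties as Any
open import Data.List.Relation.Unary.Unique.Propositional using (Unique)
open import Data.Nat.DivMod using (m<n⇒m%n≡m; n%n≡0)
import Data.Nat.Properties as ℕ
open import Data.Parity.Base using (Parity; 0ℙ; 1ℙ; _⁻¹) renaming (_+_ to _+₂_; _*_ to _*₂_)
open import Data.Product.Properties using () renaming (≡-dec to ×-≡-dec)
open import Data.Sum.Base using (_⊎_; inj₁; inj₂; [_,_]′)
open import Function.Base using (_∘_; id)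
open import Function.Bundles using (mk⇔; Equivalence; mk↔ₛ′; Inverse)
open import Relation.Binary.Definitions using (DecidableEquality; tri<; tri≈; tri>)
open import Relation.Nullary using (Dec; yes; no; contradiction)
open import Relation.Nullary.Decidable using (map′; ¬?; _×-dec_; _⊎-dec_)

-- Clauses as sets of literals.

private variable
  X : Set
  A B C D : Clause X

≈-refl : A ≈ A
≈-refl = mk⇔ id id

≈-sym : A ≈ B → B ≈ A
≈-sym e = mk⇔ (Equivalence.from e) (Equivalence.to e)

≈-trans : A ≈ B → B ≈ C → A ≈ C
≈-trans e f = mk⇔ (Equivalence.to f ∘ Equivalence.to e) (Equivalence.from e ∘ Equivalence.from f)

≈-reflexive : A ≡ B → A ≈ B
≈-reflexive refl = ≈-refl

≈[]⇒≡[] : A ≈ [] → A ≡ []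
≈[]⇒≡[] {A = []}    _ = refl
≈[]⇒≡[] {A = l ∷ A} e with () ← Equivalence.to e (here refl)

IsInput-resp : ∀ {Φ : CNF X} → A ≈ B → IsInput Φ A → IsInput Φ B
IsInput-resp e = Any.map (≈-trans (≈-sym e))

¬ˡ-involutive : (l : Literal X) → ¬ˡ (¬ˡ l) ≡ l
¬ˡ-involutive (pos _) = refl
¬ˡ-involutive (neg _) = refl

map-≈ : {X : Set} {A B : Clause X} {h h′ : Literal X → Literal X} → h ≗ h′ → A ≈ B → map h A ≈ map h′ B
map-≈ {A = A} {B} h≗h′ A≈B = Set.map-cong {xs = A} {B} h≗h′ A≈B

++-≈ : A ≈ B → C ≈ D → A ++ C ≈ B ++ D
++-≈ {A = A} {B} {C} {D} A≈B C≈D = Set.++-cong {xs₁ = A} {B} {C} {D} A≈B C≈D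

-- Resolvents over decidable variables.

module DecidableVariables {X : Set} (_≟_ : DecidableEquality X) where

  _≟ˡ_ : DecidableEquality (Literal X)
  pos x ≟ˡ pos y = map′ (cong pos) (λ { refl → refl }) (x ≟ y)
  pos x ≟ˡ neg y = no λ ()
  neg x ≟ˡ pos y = no λ ()
  neg x ≟ˡ neg y = map′ (cong neg) (λ { refl → refl }) (x ≟ y)

  open DecMembership _≟ˡ_ using (_∈?_)

  _≈?_ : (A B : Clause X) → Dec (A ≈ B)
  A ≈? B = map′ (λ (f , g) → mk⇔ (All.lookup f) (All.lookup g))
                (λ e → All.tabulate (Equivalence.to e) , All.tabulate (Equivalence.from e))
                (all? (_∈? B) A ×-dec all? (_∈? A) B)

  isInput? : ∀ Φ (A : Clause X) → Dec (IsInput Φ A)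
  isInput? Φ A = any? (A ≈?_) Φ

  infixl 6 _∖_
  _∖_ : Clause X → Literal X → Clause X
  A ∖ l = filter (λ l′ → ¬? (l′ ≟ˡ l)) A

  ∈-∖⁺ : ∀ A {l l′} → l′ ∈ A → l′ ≢ l → l′ ∈ A ∖ l
  ∈-∖⁺ A = ∈-filter⁺ _

  ∈-∖⁻ : ∀ A {l l′} → l′ ∈ A ∖ l → l′ ∈ A × l′ ≢ l
  ∈-∖⁻ A = ∈-filter⁻ _ {xs = A}

  ∖-∉ : ∀ A {l} → l ∉ A ∖ l
  ∖-∉ A l∈ = proj₂ (∈-∖⁻ A l∈) refl

  ∷-∖ : ∀ {l} → l ∈ A → A ≈ l ∷ A ∖ l
  ∷-∖ {A} {l} l∈A = mk⇔ ⇒ ⇐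
    where
    ⇒ : ∀ {l′} → l′ ∈ A → l′ ∈ l ∷ A ∖ l
    ⇒ {l′} l′∈A with l′ ≟ˡ l
    ... | yes refl = here refl
    ... | no  l′≢l = there (∈-∖⁺ A l′∈A l′≢l)

    ⇐ : ∀ {l′} → l′ ∈ l ∷ A ∖ l → l′ ∈ A
    ⇐ (here refl) = l∈A
    ⇐ (there l′∈) = proj₁ (∈-∖⁻ A l′∈)

  -- The condition `l ∉ A` leaves no freedom: removing `l` recovers `A` up to `≈`. A resolution step
  -- is thus determined by its premises and the pivot, which keeps the proof search finite.
  ∖-unique : ∀ {l} → C ≈ l ∷ A → l ∉ A → D ≈ C → D ∖ l ≈ A
  ∖-unique {C} {A} {D} {l} C≈ l∉A D≈C = mk⇔ ⇒ ⇐
    where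
    ⇒ : ∀ {l′} → l′ ∈ D ∖ l → l′ ∈ A
    ⇒ l′∈ with l′∈D , l′≢l ← ∈-∖⁻ D l′∈ | Equivalence.to C≈ (Equivalence.to D≈C l′∈D)
    ... | here eq     = contradiction eq l′≢l
    ... | there l′∈A = l′∈A

    ⇐ : ∀ {l′} → l′ ∈ A → l′ ∈ D ∖ l
    ⇐ l′∈A = ∈-∖⁺ D (Equivalence.from D≈C (Equivalence.from C≈ (there l′∈A))) λ { refl → l∉A l′∈A }

  resolvent : X → Clause X → Clause X → Clause X
  resolvent x C D = C ∖ pos x ++ D ∖ neg x

  resolvent-step : ∀ {k Φ Γ C D Cs Ds x} → (C from Cs) ∈ Γ → pos x ∈ C → (D from Ds) ∈ Γ → neg x ∈ D →
                   Step k Φ Γ (resolvent x C D from Cs ++ Ds)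
  resolvent-step {C = C} {D} C∈ x∈C D∈ x∈D = resolve C∈ (∷-∖ x∈C) (∖-∉ C) D∈ (∷-∖ x∈D) (∖-∉ D) ≈-refl

-- Finite enumerations of functions and lists.

length-cartesianProductWith : {X Y Z : Set} (f : X → Y → Z) (xs : List X) (ys : List Y) →
                              length (cartesianProductWith f xs ys) ≡ length xs * length ys
length-cartesianProductWith f []       ys = refl
length-cartesianProductWith f (x ∷ xs) ys = trans (length-++ (map (f x) ys))
  (cong₂ _+_ (length-map (f x) ys) (length-cartesianProductWith f xs ys))

module _ {X V : Set} (_≟_ : DecidableEquality X) (vs : List V) (default : X → V) where
  open DecMembership _≟_ using (_∈?_)

  override : X → V → (X → V) → X → V
  override x v f y with y ≟ x
  ... | yes _ = v
  ... | no  _ = f y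

  functions : List X → List (X → V)
  functions []       = [ default ]
  functions (x ∷ xs) = cartesianProductWith (override x) vs (functions xs)

  length-functions : ∀ xs → length (functions xs) ≡ length vs ^ length xs
  length-functions []       = refl
  length-functions (x ∷ xs) = trans (length-cartesianProductWith (override x) vs (functions xs))
                                    (cong (length vs *_) (length-functions xs))

  -- Listed functions match `g` only pointwise. The value outside `xs` is pinned to `default` so
  -- that assignments vanishing outside a given set can be enumerated.
  functions-complete : ∀ xs (g : X → V) → (∀ x → g x ∈ vs) →
                       ∃[ f ] f ∈ functions xs × (∀ x → x ∈ xs → f x ≡ g x) × (∀ x → x ∉ xs → f x ≡ default x)
  functions-complete [] g range = default , here refl , (λ _ ()) , λ _ _ → refl
  functions-complete (x ∷ xs) g range with f , f∈ , on , off ← functions-complete xs g range =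
    override x (g x) f , ∈-cartesianProductWith⁺ (override x) (range x) f∈ , on′ , off′
    where
    on′ : ∀ y → y ∈ x ∷ xs → override x (g x) f y ≡ g y
    on′ y y∈ with y ≟ x
    ... | yes refl = refl
    ... | no  y≢x with y∈
    ...   | here y≡x = contradiction y≡x y≢x
    ...   | there y∈xs = on y y∈xs

    off′ : ∀ y → y ∉ x ∷ xs → override x (g x) f y ≡ default y
    off′ y y∉ with y ≟ x
    ... | yes refl = contradiction (here refl) y∉
    ... | no  _    = off y (y∉ ∘ there)

listsUpTo : {X : Set} → List X → ℕ → List (List X)
listsUpTo xs zero    = [ [] ]
listsUpTo xs (suc k) = [] ∷ cartesianProductWith _∷_ xs (listsUpTo xs k)

∈-listsUpTo : {X : Set} {xs : List X} → (∀ x → x ∈ xs) → ∀ {k} ys → length ys ≤ k → ys ∈ listsUpTo xs k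
∈-listsUpTo complete {zero}  []       _         = here refl
∈-listsUpTo complete {suc k} []       _         = here refl
∈-listsUpTo complete {suc k} (y ∷ ys) (s≤s len) =
  there (∈-cartesianProductWith⁺ _∷_ (complete y) (∈-listsUpTo complete ys len))

-- Symmetries given by their values on variables.

extend : {X : Set} → (X → Literal X) → Literal X → Literal X
extend f (pos x) = f x
extend f (neg x) = ¬ˡ f x

extend-¬ : {X : Set} (f : X → Literal X) → ∀ l → extend f (¬ˡ l) ≡ ¬ˡ extend f l
extend-¬ f (pos x) = refl
extend-¬ f (neg x) = sym (¬ˡ-involutive (f x))

-- A symmetry commutes with negation, so its values on variables determine it; over finitely many
-- variables the symmetries become enumerable.
extend-unique : {X : Set} {f : X → Literal X} {h : Literal X → Literal X} →
                (∀ l → h (¬ˡ l) ≡ ¬ˡ h l) → (∀ x → f x ≡ h (pos x)) → extend f ≗ h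
extend-unique h-¬ f≗h (pos x) = f≗h x
extend-unique h-¬ f≗h (neg x) = trans (cong ¬ˡ_ (f≗h x)) (sym (h-¬ (pos x)))

extend-∘ : {X : Set} {f g : X → Literal X} → (∀ x → extend f (g x) ≡ pos x) → ∀ l → extend f (extend g l) ≡ l
extend-∘ {f = f} {g} inv (pos x) = inv x
extend-∘ {f = f} {g} inv (neg x) = trans (extend-¬ f (g x)) (cong ¬ˡ_ (inv x))

mkSymmetry : {X : Set} {k : ℕ} (f g : X → Literal X) →
             (∀ x → extend f (g x) ≡ pos x) → (∀ x → extend g (f x) ≡ pos x) →
             (xs : List X) → length xs ≤ k → (∀ x → x ∉ xs → f x ≡ pos x) → Symmetry X k
mkSymmetry f g fg gf xs len fix = record
  { bijection  = mk↔ₛ′ (extend f) (extend g) (extend-∘ fg) (extend-∘ gf)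
  ; respects-¬ = extend-¬ f
  ; support    = xs
  ; local      = len
  ; fixes      = fix
  }

-- Deciding whether a refutation with a given number of steps exists.

module FiniteVariables {X : Set} (_≟_ : DecidableEquality X) (xs : List X) (complete : ∀ x → x ∈ xs)
                       (k : ℕ) (Φ : CNF X) where
  open DecidableVariables _≟_
  open DecMembership _≟ˡ_ using () renaming (_∈?_ to _∈ˡ?_)
  open DecMembership _≟_ using (_∈?_)

  all-variables : {P : X → Set} → All P xs → ∀ x → P x
  all-variables ps x = All.lookup ps (complete x)

  allLiterals : List (Literal X)
  allLiterals = map pos xs ++ map neg xs

  ∈-allLiterals : ∀ l → l ∈ allLiterals
  ∈-allLiterals (pos x) = ∈-++⁺ˡ (∈-map⁺ pos (complete x))
  ∈-allLiterals (neg x) = ∈-++⁺ʳ (map pos xs) (∈-map⁺ neg (complete x))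

  maps : List (X → Literal X)
  maps = functions _≟_ allLiterals pos xs

  ∈-maps : (g : X → Literal X) → ∃[ f ] f ∈ maps × f ≗ g
  ∈-maps g with f , f∈ , on , _ ← functions-complete _≟_ allLiterals pos xs g (∈-allLiterals ∘ g) =
    f , f∈ , λ x → on x (complete x)

  IsSymmetry : (f g : X → Literal X) → List X → Set
  IsSymmetry f g ys = All (λ x → extend f (g x) ≡ pos x) xs × All (λ x → extend g (f x) ≡ pos x) xs ×
                      length ys ≤ k × All (λ x → x ∈ ys ⊎ f x ≡ pos x) xs

  isSymmetry? : ∀ f g ys → Dec (IsSymmetry f g ys)
  isSymmetry? f g ys = all? (λ x → extend f (g x) ≟ˡ pos x) xs ×-dec all? (λ x → extend g (f x) ≟ˡ pos x) xs ×-dec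
                       (length ys ℕ.≤? k) ×-dec all? (λ x → (x ∈? ys) ⊎-dec (f x ≟ˡ pos x)) xs

  -- The inverse `g` and the support are searched for along with `f`, because a symmetry carries
  -- both as data.
  SomeSymmetry : ((X → Literal X) → Set) → Set
  SomeSymmetry Q = Any (λ f → Q f × Any (λ g → Any (IsSymmetry f g) (listsUpTo xs k)) maps) maps

  someSymmetry? : {Q : (X → Literal X) → Set} → (∀ f → Dec (Q f)) → Dec (SomeSymmetry Q)
  someSymmetry? Q? = any? (λ f → Q? f ×-dec any? (λ g → any? (isSymmetry? f g) (listsUpTo xs k)) maps) maps

  someSymmetry⇒ : {Q : (X → Literal X) → Set} → SomeSymmetry Q →
                  ∃[ f ] Q f × ∃[ φ ] Symmetry.to {k = k} φ ≗ extend f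
  someSymmetry⇒ some
    with f , _ , q , some ← find some
    with g , _ , some ← find some
    with ys , _ , fg , gf , len , fix ← find some =
    f , q ,
    mkSymmetry f g (all-variables fg) (all-variables gf) ys len
      (λ x x∉ → [ (λ x∈ → contradiction x∈ x∉) , id ]′ (all-variables fix x)) ,
    λ _ → refl

  -- The enumeration yields a function that agrees with `φ` only pointwise, hence `Q` is demanded of
  -- every such function.
  ⇒someSymmetry : {Q : (X → Literal X) → Set} (φ : Symmetry X k) →
                  (∀ f → extend f ≗ Symmetry.to φ → Q f) → SomeSymmetry Q
  ⇒someSymmetry φ q
    with f , f∈ , f≗ ← ∈-maps (Symmetry.to φ ∘ pos)
       | g , g∈ , g≗ ← ∈-maps (Symmetry.from φ ∘ pos) =
    lose f∈ (q f ext-f , lose g∈ (lose (∈-listsUpTo complete support local)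
      (All.tabulate (λ {x} _ → trans (ext-f (g x)) (inverseˡ (g≗ x))) ,
       All.tabulate (λ {x} _ → trans (ext-g (f x)) (inverseʳ (f≗ x))) ,
       local ,
       All.tabulate (λ {x} _ → fixed x))))
    where
    open Symmetry φ using (to; bijection; respects-¬; support; local; fixes) renaming (from to to⁻¹)
    open Inverse bijection using (inverseˡ; inverseʳ)

    to⁻¹-¬ : ∀ l → to⁻¹ (¬ˡ l) ≡ ¬ˡ to⁻¹ l
    to⁻¹-¬ l = inverseʳ (sym (trans (respects-¬ (to⁻¹ l)) (cong ¬ˡ_ (inverseˡ refl))))

    ext-f : extend f ≗ to
    ext-f = extend-unique respects-¬ f≗

    ext-g : extend g ≗ to⁻¹
    ext-g = extend-unique to⁻¹-¬ g≗

    fixed : ∀ x → x ∈ support ⊎ f x ≡ pos x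
    fixed x with x ∈? support
    ... | yes x∈ = inj₁ x∈
    ... | no  x∉ = inj₂ (trans (f≗ x) (fixes x x∉))

  -- ℓ ⊑ ℓ′: whatever can be inferred from ℓ′ can also be inferred from ℓ.
  infix 4 _⊑_
  _⊑_ : Line X → Line X → Set
  (A from Bs) ⊑ (A′ from Bs′) = A ≈ A′ × All (λ B → Any (B ≈_) Bs′) Bs

  infix 4 _⊑*_
  _⊑*_ : List (Line X) → List (Line X) → Set
  _⊑*_ = Pointwise _⊑_

  dominating : ∀ {Γ Γ′ ℓ} → Γ′ ⊑* Γ → ℓ ∈ Γ → ∃[ ℓ′ ] ℓ′ ∈ Γ′ × ℓ′ ⊑ ℓ
  dominating (ℓ′⊑ℓ ∷ _)  (here refl) = _ , here refl , ℓ′⊑ℓ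
  dominating (_ ∷ Γ′⊑Γ) (there ℓ∈) with ℓ′ , ℓ′∈ , ℓ′⊑ℓ ← dominating Γ′⊑Γ ℓ∈ = ℓ′ , there ℓ′∈ , ℓ′⊑ℓ

  Inputs : (Literal X → Literal X) → List (Clause X) → Set
  Inputs h = All (λ B → IsInput Φ (map h B))

  Inputs-⊑ : ∀ {Bs Bs′ h h′} → h′ ≗ h → All (λ B → Any (B ≈_) Bs′) Bs → Inputs h Bs′ → Inputs h′ Bs
  Inputs-⊑ {Bs′ = Bs′} {h} {h′} h′≗h covered inputs = All.map isInput covered
    where
    isInput : ∀ {B} → Any (B ≈_) Bs′ → IsInput Φ (map h′ B)
    isInput {B} cov with B′ , B′∈ , B≈B′ ← find cov =
      IsInput-resp {A = map h B′} (≈-sym (map-≈ {A = B} h′≗h B≈B′)) (All.lookup inputs B′∈)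

  -- One representative line for each choice of rule, premises and parameters, so that all
  -- quantifiers range over finite lists.
  Infers : List (Line X) → (Line X → Set) → Set
  Infers Γ P =
    Any (λ A → P (A from [ A ])) Φ ⊎
    Any (λ (C from Cs) → Any (λ (D from Ds) → Any (λ x →
      pos x ∈ C × neg x ∈ D × P (resolvent x C D from Cs ++ Ds)) xs) Γ) Γ ⊎
    Any (λ (A from Bs) → SomeSymmetry (λ f →
      Inputs id Bs × Inputs (extend f) Bs × P (map (extend f) A from map (map (extend f)) Bs))) Γ

  infers? : ∀ Γ {P} → (∀ ℓ → Dec (P ℓ)) → Dec (Infers Γ P)
  infers? Γ P? =
    any? (λ A → P? _) Φ ⊎-dec
    any? (λ (C from Cs) → any? (λ (D from Ds) → any? (λ x →
      (pos x ∈ˡ? C) ×-dec (neg x ∈ˡ? D) ×-dec P? _) xs) Γ) Γ ⊎-dec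
    any? (λ (A from Bs) → someSymmetry? (λ f →
      inputs? id Bs ×-dec inputs? (extend f) Bs ×-dec P? _)) Γ
    where
    inputs? : ∀ h Bs → Dec (Inputs h Bs)
    inputs? h = all? (λ B → isInput? Φ (map h B))

  infers-sound : ∀ {Γ P} → Infers Γ P → ∃[ ℓ ] Step k Φ Γ ℓ × P ℓ
  infers-sound (inj₁ i) with A , A∈ , p ← find i = _ , input (lose A∈ ≈-refl) , p
  infers-sound (inj₂ (inj₁ r))
    with _ , C∈ , r ← find r
    with _ , D∈ , r ← find r
    with x , _ , x∈C , x∈D , p ← find r = _ , resolvent-step C∈ x∈C D∈ x∈D , p
  infers-sound {P = P} (inj₂ (inj₂ s))
    with (A from Bs) , A∈ , s ← find s
    with f , (inputs , inputs′ , p) , φ , φ≗ ← someSymmetry⇒ s =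
    _ ,
    symmetry A∈ φ (All.map (IsInput-resp (≈-reflexive (map-id _))) inputs)
                  (Inputs-⊑ φ≗ (All.tabulate (Any.map ≈-reflexive)) inputs′) ≈-refl ,
    subst P (cong₂ _from_ (sym (map-cong φ≗ A)) (sym (map-cong (map-cong φ≗) Bs))) p

  -- The representative is related to `ℓ` only by `⊑`, hence the hypothesis on all `ℓ′ ⊑ ℓ`. Passing
  -- to fewer sources, up to `≈`, is safe: the symmetry rule asks for a condition on each source.
  infers-complete : ∀ {Γ Γ′ P ℓ} → Step k Φ Γ ℓ → Γ′ ⊑* Γ → (∀ ℓ′ → ℓ′ ⊑ ℓ → P ℓ′) → Infers Γ′ P
  infers-complete (input i) _ p with B , B∈ , A≈B ← find i =
    inj₁ (lose B∈ (p _ (≈-sym A≈B , here (≈-sym A≈B) ∷ [])))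
  infers-complete (resolve {x = x} C∈ C≈ x∉A D∈ D≈ x∉B R≈) Γ′⊑Γ p
    with (C′ from _) , C′∈ , C′≈C , Cs′⊑ ← dominating Γ′⊑Γ C∈
       | (D′ from _) , D′∈ , D′≈D , Ds′⊑ ← dominating Γ′⊑Γ D∈ =
    inj₂ (inj₁ (lose C′∈ (lose D′∈ (lose (complete x)
      (Equivalence.from (≈-trans C′≈C C≈) (here refl) , Equivalence.from (≈-trans D′≈D D≈) (here refl) ,
       p _ (≈-trans (++-≈ (∖-unique C≈ x∉A C′≈C) (∖-unique D≈ x∉B D′≈D)) (≈-sym R≈) ,
            All.++⁺ (All.map Any.++⁺ˡ Cs′⊑) (All.map (Any.++⁺ʳ _) Ds′⊑)))))))
  infers-complete (symmetry {A = A} A∈ φ inputs inputs′ R≈) Γ′⊑Γ p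
    with (A′ from Bs′) , A′∈ , A′≈A , Bs′⊑ ← dominating Γ′⊑Γ A∈ =
    inj₂ (inj₂ (lose A′∈ (⇒someSymmetry φ λ f f≗φ →
      Inputs-⊑ (λ _ → refl) Bs′⊑ (All.map (IsInput-resp (≈-reflexive (sym (map-id _)))) inputs) ,
      Inputs-⊑ f≗φ Bs′⊑ inputs′ ,
      p _ (≈-trans (map-≈ f≗φ A′≈A) (≈-sym R≈) ,
           All.map⁺ (All.map (λ cov → Any.map⁺ (Any.map (map-≈ f≗φ) cov)) Bs′⊑)))))

  -- `t` counts the steps still to be made. At the end `≡` can stand for `≈`, since only the empty
  -- list represents the empty clause.
  Refutable : ℕ → List (Line X) → Set
  Refutable zero    []      = ⊥
  Refutable zero    (ℓ ∷ _) = Line.clause ℓ ≡ []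
  Refutable (suc t) Γ       = Infers Γ (λ ℓ → Refutable t (ℓ ∷ Γ))

  refutable? : ∀ t Γ → Dec (Refutable t Γ)
  refutable? zero    []      = no λ ()
  refutable? zero    (ℓ ∷ _) = ≡-dec _≟ˡ_ (Line.clause ℓ) []
  refutable? (suc t) Γ       = infers? Γ (λ ℓ → refutable? t (ℓ ∷ Γ))

  refutable-sound : ∀ t {Γ} → Proof k Φ Γ → Refutable t Γ → HasRefutation k Φ (t + length Γ)
  refutable-sound zero    {_ ∷ _} π refl = _ , _ , π , refl
  refutable-sound (suc t) {Γ}     π r with _ , s , r ← infers-sound r =
    subst (HasRefutation k Φ) (ℕ.+-suc t (length Γ)) (refutable-sound t (s ∷ π) r)

  -- The proof is peeled from its most recent step. Each removed step becomes one more level of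
  -- search, and quantifying over all `Γ′ ⊑* Γ` absorbs the change of representatives.
  refutable-complete : ∀ t {Γ} → Proof k Φ Γ → (∀ Γ′ → Γ′ ⊑* Γ → Refutable t Γ′) → Refutable (t + length Γ) []
  refutable-complete t [] r = subst (λ t → Refutable t []) (sym (ℕ.+-identityʳ t)) (r [] [])
  refutable-complete t {_ ∷ Γ} (s ∷ π) r = subst (λ t → Refutable t []) (sym (ℕ.+-suc t (length Γ)))
    (refutable-complete (suc t) π λ Γ′ Γ′⊑Γ → infers-complete s Γ′⊑Γ λ ℓ′ ℓ′⊑ℓ → r _ (ℓ′⊑ℓ ∷ Γ′⊑Γ))

  hasRefutation? : ∀ s → Dec (HasRefutation k Φ s)
  hasRefutation? s = map′
    (λ r → subst (HasRefutation k Φ) (ℕ.+-identityʳ s) (refutable-sound s [] r))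
    (λ { (_ , _ , π , refl) → refutable-complete 0 π λ { _ ((A≈[] , _) ∷ _) → ≈[]⇒≡[] A≈[] } })
    (refutable? s [])

least : {P : ℕ → Set} → (∀ n → Dec (P n)) → ∀ {n} → P n → ∃[ m ] (P m × (∀ k → P k → m ≤ k)) × m ≤ n
least P? {zero} p = zero , (p , λ _ _ → z≤n) , z≤n
least P? {suc n} p with P? zero
... | yes p₀ = zero , (p₀ , λ _ _ → z≤n) , z≤n
... | no ¬p₀ with m , (pm , min) , m≤n ← least (P? ∘ suc) p =
  suc m , (pm , λ { zero p₀ → contradiction p₀ ¬p₀ ; (suc k) pk → s≤s (min k pk) }) , s≤s m≤n

-- Sums in the field with two elements.

p≢1⇒p≡0 : ∀ {p} → p ≢ 1ℙ → p ≡ 0ℙ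
p≢1⇒p≡0 {0ℙ} _   = refl
p≢1⇒p≡0 {1ℙ} p≢1 = contradiction refl p≢1

p+q+q : ∀ p q → (p +₂ q) +₂ q ≡ p
p+q+q p q = trans (ℙ.+-assoc p q q) (trans (cong (p +₂_) (ℙ.p+p≡0ℙ q)) (ℙ.+-identityʳ p))

-- The edge values of a path  a′ — a — b — b′  add up to the values at its ends.
path-sum : ∀ a a′ b b′ → (a +₂ a′) +₂ ((a +₂ b) +₂ (b +₂ b′)) ≡ a′ +₂ b′
path-sum 0ℙ 0ℙ 0ℙ b′ = refl
path-sum 0ℙ 0ℙ 1ℙ 0ℙ = refl
path-sum 0ℙ 0ℙ 1ℙ 1ℙ = refl
path-sum 0ℙ 1ℙ 0ℙ b′ = refl
path-sum 0ℙ 1ℙ 1ℙ 0ℙ = refl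
path-sum 0ℙ 1ℙ 1ℙ 1ℙ = refl
path-sum 1ℙ 0ℙ 0ℙ 0ℙ = refl
path-sum 1ℙ 0ℙ 0ℙ 1ℙ = refl
path-sum 1ℙ 0ℙ 1ℙ 0ℙ = refl
path-sum 1ℙ 0ℙ 1ℙ 1ℙ = refl
path-sum 1ℙ 1ℙ 0ℙ b′ = refl
path-sum 1ℙ 1ℙ 1ℙ b′ = refl

infixl 6 _⊕_
_⊕_ : {A : Set} → (A → Parity) → (A → Parity) → A → Parity
(f ⊕ g) x = f x +₂ g x

∑ : {A : Set} → List A → (A → Parity) → Parity
∑ xs f = foldr (λ x s → f x +₂ s) 0ℙ xs

∑-cong : {A : Set} (xs : List A) {f g : A → Parity} → f ≗ g → ∑ xs f ≡ ∑ xs g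
∑-cong []       f≗g = refl
∑-cong (x ∷ xs) f≗g = cong₂ _+₂_ (f≗g x) (∑-cong xs f≗g)

∑-⊕ : {A : Set} (xs : List A) (f g : A → Parity) → ∑ xs (f ⊕ g) ≡ ∑ xs f +₂ ∑ xs g
∑-⊕ []       f g = refl
∑-⊕ (x ∷ xs) f g = trans (cong (f x +₂ g x +₂_) (∑-⊕ xs f g)) (interchange (f x) (g x) _ _)

∑-zero : {A : Set} (xs : List A) → ∑ xs (λ _ → 0ℙ) ≡ 0ℙ
∑-zero []       = refl
∑-zero (_ ∷ xs) = ∑-zero xs

∑-filter : {A : Set} {P : A → Set} (P? : ∀ x → Dec (P x)) (xs : List A) (f ω : A → Parity) →
           (∀ x → P x → ω x ≡ 1ℙ) → (∀ x → ω x ≡ 1ℙ → P x) → ∑ (filter P? xs) f ≡ ∑ xs (λ x → f x *₂ ω x)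
∑-filter P? []       f ω P⇒ω ω⇒P = refl
∑-filter P? (x ∷ xs) f ω P⇒ω ω⇒P with P? x
... | yes Px rewrite P⇒ω x Px | ℙ.*-identityʳ (f x) = cong (f x +₂_) (∑-filter P? xs f ω P⇒ω ω⇒P)
... | no ¬Px rewrite p≢1⇒p≡0 (¬Px ∘ ω⇒P x) | ℙ.*-zeroʳ (f x) = ∑-filter P? xs f ω P⇒ω ω⇒P

module Indicator {A : Set} (_≟_ : DecidableEquality A) where

  δ : A → A → Parity
  δ x y with x ≟ y
  ... | yes _ = 1ℙ
  ... | no  _ = 0ℙ

  δ-refl : ∀ x → δ x x ≡ 1ℙ
  δ-refl x with x ≟ x
  ... | yes _   = refl
  ... | no  x≢x = contradiction refl x≢x

  δ-≢ : ∀ {x y} → x ≢ y → δ x y ≡ 0ℙ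
  δ-≢ {x} {y} x≢y with x ≟ y
  ... | yes x≡y = contradiction x≡y x≢y
  ... | no  _   = refl

  δ≡1⇒≡ : ∀ {x y} → δ x y ≡ 1ℙ → x ≡ y
  δ≡1⇒≡ {x} {y} eq with x ≟ y
  ... | yes x≡y = x≡y
  δ≡1⇒≡ {x} {y} () | no _

  ∑-δ-∉ : ∀ {x} (xs : List A) (f : A → Parity) → x ∉ xs → ∑ xs (λ y → δ x y *₂ f y) ≡ 0ℙ
  ∑-δ-∉ []       f x∉ = refl
  ∑-δ-∉ {x} (y ∷ xs) f x∉ rewrite δ-≢ {x} {y} (x∉ ∘ here) = ∑-δ-∉ xs f (x∉ ∘ there)

  ∑-δ : ∀ {x xs} (f : A → Parity) → Unique xs → x ∈ xs → ∑ xs (λ y → δ x y *₂ f y) ≡ f x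
  ∑-δ {x} {_ ∷ xs} f (x≢xs ∷ _) (here refl) rewrite δ-refl x =
    trans (cong (f x +₂_) (∑-δ-∉ xs f λ x∈ → All.lookup x≢xs x∈ refl)) (ℙ.+-identityʳ (f x))
  ∑-δ {x} {y ∷ xs} f (y≢xs ∷ u) (there x∈) rewrite δ-≢ {x} {y} (λ { refl → All.lookup y≢xs x∈ refl }) =
    ∑-δ f u x∈

-- Clauses that exclude an assignment, and their resolvents.

falsified-var : {X : Set} {x y : X} {b b′ : Parity} → falsified (x , b) ≡ falsified (y , b′) → x ≡ y
falsified-var {b = 0ℙ} {0ℙ} refl = refl
falsified-var {b = 1ℙ} {1ℙ} refl = refl

-- A is the clause, on the variables in E, that excludes the assignment c.
record Excludes {X : Set} (A : Clause X) (E : X → Set) (c : X → Parity) : Set where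
  field
    sound    : ∀ {l} → l ∈ A → ∃[ x ] E x × l ≡ falsified (x , c x)
    complete : ∀ {x} → E x → falsified (x , c x) ∈ A
open Excludes

Excludes-resp : {X : Set} {A : Clause X} {E E′ : X → Set} {c c′ : X → Parity} →
                (∀ x → E x → E′ x) → (∀ x → E′ x → E x) → (∀ x → E′ x → c x ≡ c′ x) →
                Excludes A E c → Excludes A E′ c′
Excludes-resp E⇒E′ E′⇒E c≡c′ exc .sound l∈ with x , Ex , refl ← exc .sound l∈ =
  x , E⇒E′ x Ex , cong (λ b → falsified (x , b)) (c≡c′ x (E⇒E′ x Ex))
Excludes-resp {A = A} E⇒E′ E′⇒E c≡c′ exc .complete {x} E′x =
  subst (λ b → falsified (x , b) ∈ A) (c≡c′ x E′x) (exc .complete (E′⇒E x E′x))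

Excludes-≈ : {X : Set} {A B : Clause X} {E : X → Set} {c : X → Parity} →
             Excludes A E c → Excludes B E c → A ≈ B
Excludes-≈ {A = A} {B} a b = mk⇔ (⇒ a b) (⇒ b a)
  where
  ⇒ : ∀ {A B l} → Excludes A _ _ → Excludes B _ _ → l ∈ A → l ∈ B
  ⇒ a b l∈ with x , Ex , refl ← a .sound l∈ = b .complete Ex

Excludes-map : {X : Set} (xs : List X) (c : X → Parity) →
               Excludes (map (λ x → falsified (x , c x)) xs) (_∈ xs) c
Excludes-map xs c .sound l∈ = ∈-map⁻ _ l∈
Excludes-map xs c .complete = ∈-map⁺ _

module _ {X : Set} (_≟_ : DecidableEquality X) where
  open DecidableVariables _≟_

  -- Because `c₁ x` is 0 and `c₂ x` is 1, the only literals on `x` in the premises are the two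
  -- resolved away; all others follow the common `c`.
  resolvent-excludes : ∀ {C D E₁ E₂ E c₁ c₂ c x} → Excludes C E₁ c₁ → Excludes D E₂ c₂ →
    c₁ x ≡ 0ℙ → c₂ x ≡ 1ℙ → (∀ y → y ≢ x → c₁ y ≡ c y) → (∀ y → y ≢ x → c₂ y ≡ c y) →
    (∀ y → E y → y ≢ x × (E₁ y ⊎ E₂ y)) → (∀ y → y ≢ x → E₁ y ⊎ E₂ y → E y) →
    Excludes (resolvent x C D) E c
  resolvent-excludes {C} {D} {E₁} {E₂} {E} {c₁} {c₂} {c} {x} excC excD c₁x c₂x c₁≡c c₂≡c E⇒ ⇒E = record
    { sound = sound′ ; complete = complete′ }
    where
    sound′ : ∀ {l} → l ∈ resolvent x C D → ∃[ y ] E y × l ≡ falsified (y , c y)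
    sound′ l∈ with ∈-++⁻ (C ∖ pos x) l∈
    ... | inj₁ l∈ with l∈C , l≢ ← ∈-∖⁻ C l∈ with y , E₁y , refl ← excC .sound l∈C =
      y , ⇒E y y≢x (inj₁ E₁y) , cong (λ b → falsified (y , b)) (c₁≡c y y≢x)
      where
      y≢x : y ≢ x
      y≢x refl = l≢ (cong (λ b → falsified (x , b)) c₁x)
    ... | inj₂ l∈ with l∈D , l≢ ← ∈-∖⁻ D l∈ with y , E₂y , refl ← excD .sound l∈D =
      y , ⇒E y y≢x (inj₂ E₂y) , cong (λ b → falsified (y , b)) (c₂≡c y y≢x)
      where
      y≢x : y ≢ x
      y≢x refl = l≢ (cong (λ b → falsified (x , b)) c₂x)

    complete′ : ∀ {y} → E y → falsified (y , c y) ∈ resolvent x C D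
    complete′ {y} Ey with E⇒ y Ey
    ... | y≢x , inj₁ E₁y = ∈-++⁺ˡ (∈-∖⁺ C
      (subst (λ b → falsified (y , b) ∈ C) (c₁≡c y y≢x) (excC .complete E₁y)) (y≢x ∘ falsified-var {b′ = 0ℙ}))
    ... | y≢x , inj₂ E₂y = ∈-++⁺ʳ (C ∖ pos x) (∈-∖⁺ D
      (subst (λ b → falsified (y , b) ∈ D) (c₂≡c y y≢x) (excD .complete E₂y)) (y≢x ∘ falsified-var {b′ = 1ℙ}))

-- Flips of variables.

flipping : {X : Set} → (X → Parity) → X → Literal X
flipping p x = falsified (x , p x)

flipping-falsified : {X : Set} (p : X → Parity) → ∀ x b →
                     extend (flipping p) (falsified (x , b)) ≡ falsified (x , b +₂ p x)
flipping-falsified p x 0ℙ = refl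
flipping-falsified p x 1ℙ with p x
... | 0ℙ = refl
... | 1ℙ = refl

flip : {X : Set} {k : ℕ} (p : X → Parity) (xs : List X) → length xs ≤ k → (∀ x → x ∉ xs → p x ≡ 0ℙ) → Symmetry X k
flip p xs len off = mkSymmetry (flipping p) (flipping p) involutive involutive xs len
                      λ x x∉ → cong (λ b → falsified (x , b)) (off x x∉)
  where
  involutive : ∀ x → extend (flipping p) (flipping p x) ≡ pos x
  involutive x = trans (flipping-falsified p x (p x)) (cong (λ b → falsified (x , b)) (ℙ.p+p≡0ℙ (p x)))

flip-excludes : {X : Set} (p : X → Parity) {A : Clause X} {E : X → Set} {c : X → Parity} →
                Excludes A E c → Excludes (map (extend (flipping p)) A) E (c ⊕ p)
flip-excludes p {c = c} exc .sound l∈ with _ , l∈A , refl ← ∈-map⁻ _ l∈ with x , Ex , refl ← exc .sound l∈A =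
  x , Ex , flipping-falsified p x (c x)
flip-excludes p {A} {c = c} exc .complete {x} Ex =
  subst (_∈ map (extend (flipping p)) A) (flipping-falsified p x (c x)) (∈-map⁺ _ (exc .complete Ex))

-- The assignments listed in a Tseitin formula.

∈-assignments : {X : Set} (xs : List X) (c : X → Parity) → map (λ x → x , c x) xs ∈ assignments xs
∈-assignments []       c = here refl
∈-assignments (x ∷ xs) c = ∈-cartesianProductWith⁺ _∷_ (∈-values (c x)) (∈-assignments xs c)
  where
  ∈-values : ∀ b → (x , b) ∈ (x , 0ℙ) ∷ (x , 1ℙ) ∷ []
  ∈-values 0ℙ = here refl
  ∈-values 1ℙ = there (here refl)

total-map : {X : Set} (xs : List X) (c : X → Parity) → total (map (λ x → x , c x) xs) ≡ ∑ xs c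
total-map []       c = refl
total-map (x ∷ xs) c = cong (c x +₂_) (total-map xs c)

-- Derivations with a bound on the number of new lines.

module Derivations {X : Set} (k : ℕ) (Φ : CNF X) where

  -- A derivation that prolongs `Γ` at the price of `K` lines. Earlier lines are kept by inclusion,
  -- as the rules refer to their premises by membership.
  record Within (K : ℕ) (Γ : List (Line X)) (Q : List (Line X) → Set) : Set where
    constructor within
    field
      {final} : List (Line X)
      proof   : Proof k Φ final
      extends : Γ ⊆ final
      cost    : length final ≤ K + length Γ
      result  : Q final

  done : ∀ {K Γ Q} → Proof k Φ Γ → Q Γ → Within K Γ Q
  done π q = within π id (ℕ.m≤n+m _ _) q

  step : ∀ {Γ Q ℓ} → Proof k Φ Γ → Step k Φ Γ ℓ → Q (ℓ ∷ Γ) → Within 1 Γ Q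
  step π s q = within (s ∷ π) there ℕ.≤-refl q

  _>>=_ : ∀ {K K′ Γ} {Q R : List (Line X) → Set} → Within K Γ Q →
          (∀ {Γ′} → Γ ⊆ Γ′ → Proof k Φ Γ′ → Q Γ′ → Within K′ Γ′ R) → Within (K + K′) Γ R
  _>>=_ {K} {K′} {Γ} (within {Γ′} π Γ⊆ c q) f with within {Γ″} π′ Γ′⊆ c′ r ← f Γ⊆ π q =
    within π′ (Γ′⊆ ∘ Γ⊆) cost r
    where
    open ℕ.≤-Reasoning
    cost : length Γ″ ≤ K + K′ + length Γ
    cost = begin
      length Γ″                 ≤⟨ c′ ⟩
      K′ + length Γ′          ≤⟨ ℕ.+-monoʳ-≤ K′ c ⟩
      K′ + (K + length Γ)   ≡⟨ ℕ.+-assoc K′ K (length Γ) ⟨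
      K′ + K + length Γ     ≡⟨ cong (_+ length Γ) (ℕ.+-comm K′ K) ⟩
      K + K′ + length Γ     ∎

  mapResult : ∀ {K Γ} {Q R : List (Line X) → Set} → (∀ {Γ′} → Q Γ′ → R Γ′) → Within K Γ Q → Within K Γ R
  mapResult f (within π Γ⊆ c q) = within π Γ⊆ c (f q)

  relax : ∀ {K K′ Γ} {Q : List (Line X) → Set} → K ≤ K′ → Within K Γ Q → Within K′ Γ Q
  relax K≤ (within π Γ⊆ c q) = within π Γ⊆ (ℕ.≤-trans c (ℕ.+-monoˡ-≤ _ K≤)) q

  forAll : ∀ {I : Set} {K Γ} {Q : I → List (Line X) → Set} (is : List I) →
           (∀ {i Γ Γ′} → Γ ⊆ Γ′ → Q i Γ → Q i Γ′) → Proof k Φ Γ →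
           (∀ {Γ′} → Γ ⊆ Γ′ → Proof k Φ Γ′ → ∀ i → Within K Γ′ (Q i)) →
           Within (length is * K) Γ (λ Γ′ → ∀ {i} → i ∈ is → Q i Γ′)
  forAll []       mono π f = done π λ ()
  forAll (i ∷ is) mono π f =
    f id π i >>= λ Γ⊆ π′ q → forAll is mono π′ (λ Γ′⊆ → f (Γ′⊆ ∘ Γ⊆)) >>=′ λ Γ′⊆ qs →
      λ { (here refl) → mono Γ′⊆ q ; (there i∈) → qs i∈ }
    where
    _>>=′_ : ∀ {K Γ} {Q R : List (Line X) → Set} → Within K Γ Q → (∀ {Γ′} → Γ ⊆ Γ′ → Q Γ′ → R Γ′) → Within K Γ R
    within π Γ⊆ c q >>=′ f = within π Γ⊆ c (f Γ⊆ q)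

  -- Cuts off the lines after `ℓ`: a refutation has to end with the empty clause, which may have
  -- been derived anywhere in the list.
  proof-of : ∀ {Γ ℓ} → Proof k Φ Γ → ℓ ∈ Γ → ∃[ Δ ] Proof k Φ (ℓ ∷ Δ) × suc (length Δ) ≤ length Γ
  proof-of π       (here refl) = _ , π , ℕ.≤-refl
  proof-of (_ ∷ π) (there ℓ∈) with Δ , π′ , len ← proof-of π ℓ∈ = Δ , π′ , ℕ.m≤n⇒m≤1+n len

p≢q⇒p≡1+q : ∀ {p q} → p ≢ q → p ≡ 1ℙ +₂ q
p≢q⇒p≡1+q {0ℙ} {0ℙ} p≢q = contradiction refl p≢q
p≢q⇒p≡1+q {0ℙ} {1ℙ} _   = refl
p≢q⇒p≡1+q {1ℙ} {0ℙ} _   = refl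
p≢q⇒p≡1+q {1ℙ} {1ℙ} p≢q = contradiction refl p≢q

q+z≡1+q⇒z≡1 : ∀ q {z} → q +₂ z ≡ 1ℙ +₂ q → z ≡ 1ℙ
q+z≡1+q⇒z≡1 q eq = ℙ.+-cancelˡ-≡ q _ _ (trans eq (ℙ.+-comm 1ℙ q))

1+q+1 : ∀ q → 1ℙ +₂ q +₂ 1ℙ ≡ q
1+q+1 0ℙ = refl
1+q+1 1ℙ = refl

-- Opaque so that the closed costs below are compared without being computed.
opaque
  exp₂ : ℕ → ℕ
  exp₂ k = 2 ^ k

  length-functions₂ : {X : Set} (_≟_ : DecidableEquality X) {b b′ : Parity} (h : X → Parity) (xs : List X) →
                      length (functions _≟_ (b ∷ b′ ∷ []) h xs) ≡ exp₂ (length xs)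
  length-functions₂ _≟_ {b} {b′} h xs = length-functions _≟_ (b ∷ b′ ∷ []) h xs

-- Boundaries of vertex sets in a loop-free graph.

module Regions (G : Graph) (_≟ᵉ_ : DecidableEquality (Graph.Edge G))
               (loop-free : ∀ e → proj₁ (Graph.endpoints G e) ≢ proj₂ (Graph.endpoints G e)) where
  open Graph G
  open Indicator _≟ᵛ_ using () renaming (δ to δᵛ; δ-refl to δᵛ-refl; δ-≢ to δᵛ-≢; δ≡1⇒≡ to δᵛ≡1⇒≡)
  open Indicator _≟ᵉ_ using (δ; δ-refl; δ-≢; δ≡1⇒≡; ∑-δ)
  open DecMembership _≟ᵉ_ using (_∈?_)
  open DecidableVariables _≟ᵉ_ using (resolvent; resolvent-step)

  Φ : CNF Edge
  Φ = tseitin G (λ _ → 1ℙ)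

  open Derivations 3 Φ

  -- A set of vertices is given by its indicator χ; the edges on its boundary are those e with ∂ χ e ≡ 1ℙ.
  ∂ : (Vertex → Parity) → Edge → Parity
  ∂ χ e = χ (proj₁ (endpoints e)) +₂ χ (proj₂ (endpoints e))

  ∂-⊕ : ∀ χ ψ e → ∂ (χ ⊕ ψ) e ≡ ∂ χ e +₂ ∂ ψ e
  ∂-⊕ χ ψ e = interchange (χ (proj₁ (endpoints e))) (ψ (proj₁ (endpoints e))) _ _

  -- The bilinear pairing of edge vectors. Against `∂ χ` it evaluates the left-hand side of the sum
  -- of the equations in `χ`, in which interior edges cancel.
  ⟨_,_⟩ : (Edge → Parity) → (Edge → Parity) → Parity
  ⟨ c , ω ⟩ = ∑ edges (λ e → c e *₂ ω e)

  ⟨⟩-cong : ∀ {c c′ ω ω′} → (∀ e → ω′ e ≡ 1ℙ → c e ≡ c′ e) → ω ≗ ω′ → ⟨ c , ω ⟩ ≡ ⟨ c′ , ω′ ⟩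
  ⟨⟩-cong {c} {c′} {ω} {ω′} c≡c′ ω≗ω′ = ∑-cong edges eq
    where
    eq : ∀ e → c e *₂ ω e ≡ c′ e *₂ ω′ e
    eq e rewrite ω≗ω′ e with ω′ e in ω′e
    ... | 0ℙ = trans (ℙ.*-zeroʳ (c e)) (sym (ℙ.*-zeroʳ (c′ e)))
    ... | 1ℙ = cong (_*₂ 1ℙ) (c≡c′ e ω′e)

  ⟨⊕,⟩ : ∀ c d ω → ⟨ c ⊕ d , ω ⟩ ≡ ⟨ c , ω ⟩ +₂ ⟨ d , ω ⟩
  ⟨⊕,⟩ c d ω = trans (∑-cong edges λ e → ℙ.*-distribʳ-+ (ω e) (c e) (d e))
    (∑-⊕ edges (λ e → c e *₂ ω e) (λ e → d e *₂ ω e))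

  ⟨,⊕⟩ : ∀ c ω ω′ → ⟨ c , ω ⊕ ω′ ⟩ ≡ ⟨ c , ω ⟩ +₂ ⟨ c , ω′ ⟩
  ⟨,⊕⟩ c ω ω′ = trans (∑-cong edges λ e → ℙ.*-distribˡ-+ (c e) (ω e) (ω′ e))
    (∑-⊕ edges (λ e → c e *₂ ω e) (λ e → c e *₂ ω′ e))

  ⟨δ,⟩ : ∀ x ω → ⟨ δ x , ω ⟩ ≡ ω x
  ⟨δ,⟩ x ω = ∑-δ ω edges-unique (edges-complete x)

  ⟨c⊕δ,⟩ : ∀ c x ω → ⟨ c ⊕ δ x , ω ⟩ ≡ ⟨ c , ω ⟩ +₂ ω x
  ⟨c⊕δ,⟩ c x ω = trans (⟨⊕,⟩ c (δ x) ω) (cong (⟨ c , ω ⟩ +₂_) (⟨δ,⟩ x ω))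

  -- At a loop the two contributions of `v` would cancel; `loop-free` rules this out.
  incident⇒∂ : ∀ e {v} → e ∋ᵛ v → ∂ (δᵛ v) e ≡ 1ℙ
  incident⇒∂ e {v} (inj₁ refl) rewrite δᵛ-refl v | δᵛ-≢ (loop-free e) = refl
  incident⇒∂ e {v} (inj₂ refl) rewrite δᵛ-refl v | δᵛ-≢ (loop-free e ∘ sym) = refl

  ∂⇒incident : ∀ e {v} → ∂ (δᵛ v) e ≡ 1ℙ → e ∋ᵛ v
  ∂⇒incident e {v} eq with v ≟ᵛ proj₁ (endpoints e) | v ≟ᵛ proj₂ (endpoints e)
  ... | yes p | _     = inj₁ (sym p)
  ... | no _  | yes p = inj₂ (sym p)
  ∂⇒incident e () | no _ | no _

  -- Input clauses at a vertex and lines derived from a region.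

  vertexClause : Vertex → (Edge → Parity) → Clause Edge
  vertexClause v c = map (λ e → falsified (e , c e)) (incident v)

  vertexClause-excludes : ∀ v c → Excludes (vertexClause v c) (λ e → ∂ (δᵛ v) e ≡ 1ℙ) c
  vertexClause-excludes v c = Excludes-resp
    (λ e e∈ → incident⇒∂ e (proj₂ (∈-filter⁻ (_∋ᵛ? v) {xs = edges} e∈)))
    (λ e ∂e → ∈-filter⁺ (_∋ᵛ? v) (edges-complete e) (∂⇒incident e ∂e))
    (λ _ _ → refl)
    (Excludes-map (incident v) c)

  -- All charges are 1, so an assignment with even sum at `v` violates the equation there.
  vertexClause-isInput : ∀ v c → ⟨ c , ∂ (δᵛ v) ⟩ ≡ 0ℙ → IsInput Φ (vertexClause v c)
  vertexClause-isInput v c even = lose (∈-concatMap⁺ _ (lose (vertices-complete v) excluded)) ≈-refl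
    where
    a : Assignment Edge
    a = map (λ e → e , c e) (incident v)

    total≢1 : total a ≢ 1ℙ
    total≢1 odd with () ← trans (sym odd) (trans (total-map (incident v) c)
      (trans (∑-filter (_∋ᵛ? v) edges c (∂ (δᵛ v)) (λ e → incident⇒∂ e) (λ e → ∂⇒incident e)) even))

    excluded : vertexClause v c ∈ map excluding (violating G (λ _ → 1ℙ) v)
    excluded = subst (_∈ map excluding (violating G (λ _ → 1ℙ) v)) (sym (map-∘ (incident v)))
      (∈-map⁺ excluding (∈-filter⁺ (λ a → ¬? (total a ℙ.≟ 1ℙ)) (∈-assignments (incident v) c) total≢1))

  -- The vertex and the excluded assignment are remembered, so that the image under a flip can be
  -- recognised as an input clause too.
  InputAt : (Vertex → Parity) → Clause Edge → Set
  InputAt χ B = ∃[ v ] ∃[ c ] χ v ≡ 1ℙ × ⟨ c , ∂ (δᵛ v) ⟩ ≡ 0ℙ × Excludes B (λ e → ∂ (δᵛ v) e ≡ 1ℙ) c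

  InputAt⇒IsInput : ∀ {χ B} → InputAt χ B → IsInput Φ B
  InputAt⇒IsInput (v , c , _ , even , exc) =
    IsInput-resp (Excludes-≈ (vertexClause-excludes v c) exc) (vertexClause-isInput v c even)

  -- The sources are confined to vertices of `χ`, since a flip is only required to preserve the
  -- equations there.
  record Has (χ : Vertex → Parity) (E : Edge → Set) (c : Edge → Parity) (Γ : List (Line Edge)) : Set where
    constructor has
    field
      {clause}  : Clause Edge
      {sources} : List (Clause Edge)
      line      : (clause from sources) ∈ Γ
      excludes  : Excludes clause E c
      inputs    : All (InputAt χ) sources

  Has-mono : ∀ {χ E c Γ Γ′} → Γ ⊆ Γ′ → Has χ E c Γ → Has χ E c Γ′
  Has-mono Γ⊆ (has l e i) = has (Γ⊆ l) e i

  Has-resp : ∀ {χ χ′ E E′ c c′ Γ} → (∀ v → χ v ≡ 1ℙ → χ′ v ≡ 1ℙ) → (∀ x → E x → E′ x) → (∀ x → E′ x → E x) →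
             (∀ x → E′ x → c x ≡ c′ x) → Has χ E c Γ → Has χ′ E′ c′ Γ
  Has-resp χ⇒ E⇒ ⇒E c≡ (has l e i) =
    has l (Excludes-resp E⇒ ⇒E c≡ e) (All.map (λ (v , d , χv , rest) → v , d , χ⇒ v χv , rest) i)

  -- The excluded assignments differ exactly at `x`; the value `c x` decides which of the two
  -- premises contains `pos x`.
  Has-resolve : ∀ {χ E₁ E₂ E c x Γ} → Has χ E₁ c Γ → Has χ E₂ (c ⊕ δ x) Γ → E₁ x → E₂ x →
                (∀ y → E y → y ≢ x × (E₁ y ⊎ E₂ y)) → (∀ y → y ≢ x → E₁ y ⊎ E₂ y → E y) →
                Proof 3 Φ Γ → Within 1 Γ (Has χ E c)
  Has-resolve {χ} {E = E} {c} {x} {Γ} (has {C} C∈ excC inC) (has {D} D∈ excD inD) E₁x E₂x E⇒ ⇒E π = cases (c x) refl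
    where
    off : ∀ y → y ≢ x → (c ⊕ δ x) y ≡ c y
    off y y≢x = trans (cong (c y +₂_) (δ-≢ (y≢x ∘ sym))) (ℙ.+-identityʳ (c y))

    at : ∀ {b} → c x ≡ b → (c ⊕ δ x) x ≡ b +₂ 1ℙ
    at cx = cong₂ _+₂_ cx (δ-refl x)

    cases : ∀ b → c x ≡ b → Within 1 Γ (Has χ E c)
    cases 0ℙ cx = step π
      (resolvent-step C∈ (subst (λ b → falsified (x , b) ∈ C) cx (excC .complete E₁x))
                      D∈ (subst (λ b → falsified (x , b) ∈ D) (at cx) (excD .complete E₂x)))
      (has (here refl) (resolvent-excludes _≟ᵉ_ excC excD cx (at cx) (λ _ _ → refl) off E⇒ ⇒E) (All.++⁺ inC inD))
    cases 1ℙ cx = step π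
      (resolvent-step D∈ (subst (λ b → falsified (x , b) ∈ D) (at cx) (excD .complete E₂x))
                      C∈ (subst (λ b → falsified (x , b) ∈ C) cx (excC .complete E₁x)))
      (has (here refl) (resolvent-excludes _≟ᵉ_ excD excC (at cx) cx off (λ _ _ → refl)
        (λ y Ey → let y≢x , E₁⊎E₂ = E⇒ y Ey in y≢x , [ inj₂ , inj₁ ]′ E₁⊎E₂)
        (λ y y≢x E₂⊎E₁ → ⇒E y y≢x ([ inj₂ , inj₁ ]′ E₂⊎E₁))) (All.++⁺ inD inC))

  Has-input : ∀ {χ v c Γ} → χ v ≡ 1ℙ → ⟨ c , ∂ (δᵛ v) ⟩ ≡ 0ℙ → Proof 3 Φ Γ →
              Within 1 Γ (Has χ (λ e → ∂ (δᵛ v) e ≡ 1ℙ) c)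
  Has-input {v = v} {c} χv even π = step π (input (vertexClause-isInput v c even))
    (has (here refl) (vertexClause-excludes v c) ((v , c , χv , even , vertexClause-excludes v c) ∷ []))

  -- The flip changes the sum at a vertex of `χ` by the pairing of `p` with its boundary, which is
  -- 0. Every source thus goes to an input clause at the same vertex.
  Has-flip : ∀ {χ E c Γ} p xs → length xs ≤ 3 → (∀ x → x ∉ xs → p x ≡ 0ℙ) →
             (∀ v → χ v ≡ 1ℙ → ⟨ p , ∂ (δᵛ v) ⟩ ≡ 0ℙ) →
             Has χ E c Γ → Proof 3 Φ Γ → Within 1 Γ (Has χ E (c ⊕ p))
  Has-flip {χ} {E} {c} p xs len off even (has l exc ins) π = step π
    (symmetry l φ (All.map InputAt⇒IsInput ins) (All.map (InputAt⇒IsInput ∘ flipped) ins) ≈-refl)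
    (has (here refl) (flip-excludes p exc) (All.map⁺ (All.map flipped ins)))
    where
    φ : Symmetry Edge 3
    φ = flip p xs len off

    flipped : ∀ {B} → InputAt χ B → InputAt χ (φ · B)
    flipped (v , d , χv , evenᵈ , excᵈ) =
      v , d ⊕ p , χv , trans (⟨⊕,⟩ d p _) (cong₂ _+₂_ evenᵈ (even v χv)) , flip-excludes p excᵈ

  -- Families of clauses with restricted negative literals.

  Supported : (Edge → Set) → (Edge → Parity) → List Edge → Set
  Supported E c J = ∀ e → E e → c e ≡ 1ℙ → e ∈ J

  -- The value 1 is excluded by a negative literal, so support in `J` means that literals outside
  -- `J` are positive. `q` is the parity that violates the equation with left-hand side `ω`.
  Family : (Vertex → Parity) → (Edge → Set) → List Edge → (Edge → Parity) → Parity → List (Line Edge) → Set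
  Family χ E J ω q Γ = ∀ c → Supported E c J → ⟨ c , ω ⟩ ≡ q → Has χ E c Γ

  -- Clearing `c` outside `J` changes it nowhere on `E`, so the assignments that vanish outside `J`
  -- represent the whole family; there are 2 to the power `length J` of them.
  Family-build : ∀ {χ E J ω q K Γ} → (∀ e → ω e ≡ 1ℙ → E e) → Proof 3 Φ Γ →
    (∀ {Γ′} → Γ ⊆ Γ′ → Proof 3 Φ Γ′ → ∀ c → Supported E c J → ⟨ c , ω ⟩ ≡ q → Within K Γ′ (Has χ E c)) →
    Within (exp₂ (length J) * K) Γ (Family χ E J ω q)
  Family-build {χ} {E} {J} {ω} {q} {K} {Γ} ω⇒E π derive =
    subst (λ N → Within (N * K) Γ (Family χ E J ω q)) (length-functions₂ _≟ᵉ_ zeros J)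
      (mapResult all
        (forAll {Q = λ c Γ′ → (∀ e → e ∉ J → c e ≡ 0ℙ) → ⟨ c , ω ⟩ ≡ q → Has χ E c Γ′}
          cs (λ Γ⊆ h off even → Has-mono Γ⊆ (h off even)) π one))
    where
    bits : List Parity
    bits = 0ℙ ∷ 1ℙ ∷ []

    ∈-bits : ∀ b → b ∈ bits
    ∈-bits 0ℙ = here refl
    ∈-bits 1ℙ = there (here refl)

    zeros : Edge → Parity
    zeros _ = 0ℙ

    cs : List (Edge → Parity)
    cs = functions _≟ᵉ_ bits zeros J

    supported : ∀ c → (∀ e → e ∉ J → c e ≡ 0ℙ) → Supported E c J
    supported c off e _ ce with e ∈? J
    ... | yes e∈ = e∈
    ... | no  e∉ with () ← trans (sym ce) (off e e∉)

    one : ∀ {Γ′} → Γ ⊆ Γ′ → Proof 3 Φ Γ′ → ∀ c →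
          Within K Γ′ (λ Γ″ → (∀ e → e ∉ J → c e ≡ 0ℙ) → ⟨ c , ω ⟩ ≡ q → Has χ E c Γ″)
    -- The conditions on a listed `c` are tested; a candidate that fails one is settled vacuously,
    -- without new lines.
    one Γ⊆ π c with all? (λ e → (e ∈? J) ⊎-dec (c e ℙ.≟ 0ℙ)) edges | ⟨ c , ω ⟩ ℙ.≟ q
    ... | yes off | yes even = mapResult (λ h _ _ → h) (derive Γ⊆ π c (supported c λ e e∉ →
            [ (λ e∈ → contradiction e∈ e∉) , id ]′ (All.lookup off (edges-complete e))) even)
    ... | _       | no odd   = done π λ _ even → contradiction even odd
    ... | no ¬off | _        = done π λ off → contradiction (All.tabulate λ {e} _ → dichotomy off e) ¬off
      where
      dichotomy : (∀ e → e ∉ J → c e ≡ 0ℙ) → ∀ e → e ∈ J ⊎ c e ≡ 0ℙ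
      dichotomy off e with e ∈? J
      ... | yes e∈ = inj₁ e∈
      ... | no  e∉ = inj₂ (off e e∉)

    all : ∀ {Γ′} → (∀ {c} → c ∈ cs → (∀ e → e ∉ J → c e ≡ 0ℙ) → ⟨ c , ω ⟩ ≡ q → Has χ E c Γ′) → Family χ E J ω q Γ′
    all hs c supp even with f , f∈ , on , off ← functions-complete _≟ᵉ_ bits zeros J c (∈-bits ∘ c) =
      Has-resp (λ _ → id) (λ _ → id) (λ _ → id) agree
        (hs f∈ off (trans (⟨⟩-cong (λ e ωe → agree e (ω⇒E e ωe)) (λ _ → refl)) even))
      where
      agree : ∀ e → E e → f e ≡ c e
      agree e Ee with e ∈? J
      ... | yes e∈ = on e e∈
      ... | no  e∉ = trans (off e e∉) (sym (p≢1⇒p≡0 (e∉ ∘ supp e Ee)))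

  -- The sweep invariant and its extension by flips.

  Boundary : (Vertex → Parity) → Edge → Set
  Boundary χ e = ∂ χ e ≡ 1ℙ

  -- Every clause on the boundary of χ that follows from the equations in χ and whose literals are positive
  -- outside I has been derived from them.
  State : (Vertex → Parity) → List Edge → Parity → List (Line Edge) → Set
  State χ I q = Family χ (Boundary χ) I (∂ χ) q

  -- Only boundary edges occur in the clauses, so `I′` may list interior or unswept edges freely.
  State-weaken : ∀ {χ χ′ I I′ q Γ} → χ ≗ χ′ → (∀ e → Boundary χ′ e → e ∈ I′ → e ∈ I) → State χ I q Γ → State χ′ I′ q Γ
  State-weaken {χ} {χ′} χ≗χ′ I′⊆I st c supp even =
    Has-resp (λ v → trans (sym (χ≗χ′ v))) (λ e → trans (sym (∂≗ e))) (λ e → trans (∂≗ e)) (λ _ _ → refl)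
      (st c (λ e ∂e ce → let ∂′e = trans (sym (∂≗ e)) ∂e in I′⊆I e ∂′e (supp e ∂′e ce))
          (trans (⟨⟩-cong {c} (λ _ _ → refl) ∂≗) even))
    where
    ∂≗ : ∂ χ ≗ ∂ χ′
    ∂≗ e = cong₂ _+₂_ (χ≗χ′ _) (χ≗χ′ _)

  -- A flip along the path a′  -  a  -  b  -  b′ with edges `e`, `m`, `e′`. It changes sums only at
  -- the ends, which lie outside `χ`. A clause negative at `e′` is the image of one positive at `e′`
  -- and altered at `e ∈ I`.
  State-extend : ∀ {χ I q Γ} a a′ b b′ {e m e′} → χ a ≡ 1ℙ → χ a′ ≡ 0ℙ → χ b ≡ 1ℙ → χ b′ ≡ 0ℙ →
    (∀ ψ → ∂ ψ e ≡ ψ a +₂ ψ a′) → (∀ ψ → ∂ ψ m ≡ ψ a +₂ ψ b) → (∀ ψ → ∂ ψ e′ ≡ ψ b +₂ ψ b′) →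
    e ∈ I → State χ I q Γ → Proof 3 Φ Γ → Within (exp₂ (length (e′ ∷ I)) * 1) Γ (State χ (e′ ∷ I) q)
  State-extend {χ} {I} {q} a a′ b b′ {e} {m} {e′} χa χa′ χb χb′ ∂e ∂m ∂e′ e∈I st π =
    Family-build (λ _ → id) π λ Γ⊆ π c supp even → cases Γ⊆ π c supp even (c e′) refl
    where
    p : Edge → Parity
    p = δ e ⊕ (δ m ⊕ δ e′)

    ⟨p,⟩ : ∀ ψ → ⟨ p , ∂ ψ ⟩ ≡ ψ a′ +₂ ψ b′
    ⟨p,⟩ ψ = trans (⟨⊕,⟩ (δ e) _ _) (trans (cong₂ _+₂_ (trans (⟨δ,⟩ e _) (∂e ψ))
      (trans (⟨⊕,⟩ (δ m) _ _) (cong₂ _+₂_ (trans (⟨δ,⟩ m _) (∂m ψ)) (trans (⟨δ,⟩ e′ _) (∂e′ ψ)))))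
      (path-sum (ψ a) (ψ a′) (ψ b) (ψ b′)))

    outside : ∀ {v w} → χ v ≡ 1ℙ → χ w ≡ 0ℙ → δᵛ v w ≡ 0ℙ
    outside χv χw = δᵛ-≢ λ { refl → contradiction (trans (sym χv) χw) λ () }

    p-off : ∀ x → x ∉ e ∷ m ∷ e′ ∷ [] → p x ≡ 0ℙ
    p-off x x∉ rewrite δ-≢ {e} {x} (x∉ ∘ here ∘ sym) | δ-≢ {m} {x} (x∉ ∘ there ∘ here ∘ sym)
                     | δ-≢ {e′} {x} (x∉ ∘ there ∘ there ∘ here ∘ sym) = refl

    supp′ : ∀ c → Supported (Boundary χ) c (e′ ∷ I) → c e′ ≡ 1ℙ → Supported (Boundary χ) (c ⊕ p) I
    supp′ c supp ce′ x ∂x cpx with e ≟ᵉ x | m ≟ᵉ x | e′ ≟ᵉ x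
    ... | yes refl | _        | _        = e∈I
    -- The middle edge joins two vertices of `χ`, so it is not on the boundary and its flip is
    -- invisible in the clause.
    ... | no _     | yes refl | _        = contradiction (trans (sym ∂x) (trans (∂m χ) (cong₂ _+₂_ χa χb))) λ ()
    ... | no _     | no _     | yes refl = contradiction (trans (sym cpx) (cong (_+₂ 1ℙ) ce′)) λ ()
    ... | no _     | no _     | no e′≢x with supp x ∂x (trans (sym (ℙ.+-identityʳ (c x))) cpx)
    ...   | here x≡e′ = contradiction (sym x≡e′) e′≢x
    ...   | there x∈I = x∈I

    cases : ∀ {Γ′} → _ ⊆ Γ′ → Proof 3 Φ Γ′ → ∀ c → Supported (Boundary χ) c (e′ ∷ I) → ⟨ c , ∂ χ ⟩ ≡ q →
            ∀ b → c e′ ≡ b → Within 1 Γ′ (Has χ (Boundary χ) c)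
    cases Γ⊆ π c supp even 0ℙ ce′ = done π (Has-mono Γ⊆ (st c supp₀ even))
      where
      supp₀ : Supported (Boundary χ) c I
      supp₀ x ∂x cx with supp x ∂x cx
      ... | here refl = contradiction (trans (sym cx) ce′) λ ()
      ... | there x∈I = x∈I
    -- The flip is applied to the clause for `c ⊕ p`; flipping twice returns to `c`.
    cases Γ⊆ π c supp even 1ℙ ce′ = mapResult
      (Has-resp (λ _ → id) (λ _ → id) (λ _ → id) (λ x _ → p+q+q (c x) (p x)))
      (Has-flip p (e ∷ m ∷ e′ ∷ []) ℕ.≤-refl p-off
        (λ v χv → trans (⟨p,⟩ (δᵛ v)) (cong₂ _+₂_ (outside χv χa′) (outside χv χb′)))
        (Has-mono Γ⊆ (st (c ⊕ p) (supp′ c supp ce′)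
          (trans (⟨⊕,⟩ c p _) (trans (cong (⟨ c , ∂ χ ⟩ +₂_) (trans (⟨p,⟩ χ) (cong₂ _+₂_ χa′ χb′)))
            (trans (ℙ.+-identityʳ _) even)))))
        π)

  -- Adding a vertex to a region.

  module AddVertex (χ : Vertex → Parity) (v : Vertex) (χv : χ v ≡ 0ℙ) (I N : List Edge)
                   (N⇒∂ : ∀ {e} → e ∈ N → ∂ (δᵛ v) e ≡ 1ℙ) (∂⇒N : ∀ {e} → ∂ (δᵛ v) e ≡ 1ℙ → e ∈ N)
                   (q : Parity) where

    χ′ : Vertex → Parity
    χ′ = χ ⊕ δᵛ v

    J : List Edge
    J = I ++ N

    χ′v : χ′ v ≡ 1ℙ
    χ′v = cong₂ _+₂_ χv (δᵛ-refl v)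

    χ⇒χ′ : ∀ w → χ w ≡ 1ℙ → χ′ w ≡ 1ℙ
    χ⇒χ′ w χw = cong₂ _+₂_ χw (δᵛ-≢ λ { refl → contradiction (trans (sym χw) χv) λ () })

    ∂′ : ∀ e → ∂ χ′ e ≡ ∂ χ e +₂ ∂ (δᵛ v) e
    ∂′ = ∂-⊕ χ (δᵛ v)

    Shared : Edge → Set
    Shared e = ∂ χ e ≡ 1ℙ × ∂ (δᵛ v) e ≡ 1ℙ

    Shared⇒∂′ : ∀ {e} → Shared e → ∂ χ′ e ≡ 0ℙ
    Shared⇒∂′ {e} (∂e , ∂ᵛe) = trans (∂′ e) (cong₂ _+₂_ ∂e ∂ᵛe)

    -- The union of the two boundaries, less the shared edges `P` already resolved away. Once `P`
    -- holds all shared edges, this is the boundary of `χ′`.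
    Joint : List Edge → Edge → Set
    Joint P e = (∂ χ e ≡ 1ℙ ⊎ ∂ (δᵛ v) e ≡ 1ℙ) × e ∉ P

    ∂′⇒Joint : ∀ P → (∀ {e} → e ∈ P → Shared e) → ∀ e → ∂ χ′ e ≡ 1ℙ → Joint P e
    ∂′⇒Joint P shared e ∂′e =
      either (∂ χ e) refl , λ e∈ → contradiction (trans (sym ∂′e) (Shared⇒∂′ (shared e∈))) λ ()
      where
      either : ∀ b → ∂ χ e ≡ b → ∂ χ e ≡ 1ℙ ⊎ ∂ (δᵛ v) e ≡ 1ℙ
      either 1ℙ ∂e = inj₁ ∂e
      either 0ℙ ∂e = inj₂ (trans (cong (_+₂ ∂ (δᵛ v) e) (sym ∂e)) (trans (sym (∂′ e)) ∂′e))

    Joint⇒∂′ : ∀ P → (∀ {e} → Shared e → e ∈ P) → ∀ e → Joint P e → ∂ χ′ e ≡ 1ℙ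
    Joint⇒∂′ P shared e (∂e⊎∂ᵛe , e∉) = trans (∂′ e) (sum (∂ χ e) (∂ (δᵛ v) e) refl refl ∂e⊎∂ᵛe)
      where
      sum : ∀ b b′ → ∂ χ e ≡ b → ∂ (δᵛ v) e ≡ b′ → ∂ χ e ≡ 1ℙ ⊎ ∂ (δᵛ v) e ≡ 1ℙ → b +₂ b′ ≡ 1ℙ
      sum 0ℙ 1ℙ _ _ _ = refl
      sum 1ℙ 0ℙ _ _ _ = refl
      sum 1ℙ 1ℙ ∂e ∂ᵛe _ = contradiction (shared (∂e , ∂ᵛe)) e∉
      sum 0ℙ 0ℙ ∂e _ (inj₁ ∂e′) = trans (sym ∂e) ∂e′
      sum 0ℙ 0ℙ _ ∂ᵛe (inj₂ ∂ᵛe′) = trans (sym ∂ᵛe) ∂ᵛe′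

    -- The vertex contributes charge 1, which turns the violating parity `q` into `1ℙ +₂ q`.
    Stage : List Edge → List (Line Edge) → Set
    Stage P = Family χ′ (Joint P) J (∂ χ′) (1ℙ +₂ q)

    module _ (shared⇒I : ∀ {e} → Shared e → e ∈ I) where

      split : ∀ {c} → ⟨ c , ∂ χ′ ⟩ ≡ 1ℙ +₂ q → ⟨ c , ∂ χ ⟩ +₂ ⟨ c , ∂ (δᵛ v) ⟩ ≡ 1ℙ +₂ q
      split {c} even = trans (sym (⟨,⊕⟩ c (∂ χ) (∂ (δᵛ v)))) (trans (⟨⟩-cong {c} (λ _ _ → refl) (sym ∘ ∂′)) even)

      Shared-J⇒I : ∀ {e} → ∂ χ e ≡ 1ℙ → e ∈ J → e ∈ I
      Shared-J⇒I ∂e e∈ = [ id , (λ e∈N → shared⇒I (∂e , N⇒∂ e∈N)) ]′ (∈-++⁻ I e∈)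

      -- Of c and c ⊕ δ x, one violates the sum of the equations in χ and the other the equation at v.
      open-stage : ∀ {x Γ} → Shared x → State χ I q Γ → Proof 3 Φ Γ → Within (exp₂ (length J) * 2) Γ (Stage [ x ])
      open-stage {x} {Γ} (∂x , ∂ᵛx) st π = Family-build (∂′⇒Joint [ x ] λ { (here refl) → ∂x , ∂ᵛx }) π one
        where
        joint⇒ : ∀ y → Joint [ x ] y → y ≢ x × (∂ χ y ≡ 1ℙ ⊎ ∂ (δᵛ v) y ≡ 1ℙ)
        joint⇒ y (E , y∉) = y∉ ∘ here , E

        ⇒joint : ∀ y → y ≢ x → ∂ χ y ≡ 1ℙ ⊎ ∂ (δᵛ v) y ≡ 1ℙ → Joint [ x ] y
        ⇒joint y y≢x E = E , λ { (here refl) → y≢x refl }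

        one : ∀ {Γ′} → Γ ⊆ Γ′ → Proof 3 Φ Γ′ → ∀ c → Supported (Joint [ x ]) c J → ⟨ c , ∂ χ′ ⟩ ≡ 1ℙ +₂ q →
              Within 2 Γ′ (Has χ′ (Joint [ x ]) c)
        one Γ⊆ π c supp even with ⟨ c , ∂ χ ⟩ ℙ.≟ q
        ... | yes ⟨c,∂χ⟩ = Has-input χ′v evenᵛ π >>= λ Γ′⊆ π hᵛ →
          Has-resolve (Has-resp χ⇒χ′ (λ _ → id) (λ _ → id) (λ _ _ → refl)
                         (Has-mono (Γ′⊆ ∘ Γ⊆) (st c supp′ ⟨c,∂χ⟩)))
            hᵛ ∂x ∂ᵛx joint⇒ ⇒joint π
          where
          supp′ : Supported (Boundary χ) c I
          supp′ e ∂e ce with e ≟ᵉ x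
          ... | yes refl = shared⇒I (∂x , ∂ᵛx)
          ... | no  e≢x  = Shared-J⇒I ∂e (supp e (⇒joint e e≢x (inj₁ ∂e)) ce)

          evenᵛ : ⟨ c ⊕ δ x , ∂ (δᵛ v) ⟩ ≡ 0ℙ
          evenᵛ = trans (⟨c⊕δ,⟩ c x _) (cong₂ _+₂_
            (q+z≡1+q⇒z≡1 q (trans (cong (_+₂ _) (sym ⟨c,∂χ⟩)) (split {c} even))) ∂ᵛx)
        ... | no ⟨c,∂χ⟩≢q = Has-input χ′v evenᵛ π >>= λ Γ′⊆ π hᵛ →
          Has-resolve hᵛ (Has-resp χ⇒χ′ (λ _ → id) (λ _ → id) (λ _ _ → refl)
                            (Has-mono (Γ′⊆ ∘ Γ⊆) (st (c ⊕ δ x) supp′ evenχ)))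
            ∂ᵛx ∂x (λ y Jy → let y≢x , E = joint⇒ y Jy in y≢x , [ inj₂ , inj₁ ]′ E)
            (λ y y≢x E → ⇒joint y y≢x ([ inj₂ , inj₁ ]′ E)) π
          where
          ⟨c,∂χ⟩ : ⟨ c , ∂ χ ⟩ ≡ 1ℙ +₂ q
          ⟨c,∂χ⟩ = p≢q⇒p≡1+q ⟨c,∂χ⟩≢q

          supp′ : Supported (Boundary χ) (c ⊕ δ x) I
          supp′ e ∂e ce with x ≟ᵉ e
          ... | yes refl = shared⇒I (∂x , ∂ᵛx)
          ... | no  x≢e  = Shared-J⇒I ∂e
            (supp e (⇒joint e (x≢e ∘ sym) (inj₁ ∂e)) (trans (sym (ℙ.+-identityʳ (c e))) ce))

          evenᵛ : ⟨ c , ∂ (δᵛ v) ⟩ ≡ 0ℙ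
          evenᵛ = ℙ.+-cancelˡ-≡ (1ℙ +₂ q) _ _
            (trans (cong (_+₂ _) (sym ⟨c,∂χ⟩)) (trans (split {c} even) (sym (ℙ.+-identityʳ (1ℙ +₂ q)))))

          evenχ : ⟨ c ⊕ δ x , ∂ χ ⟩ ≡ q
          evenχ = trans (⟨c⊕δ,⟩ c x _) (trans (cong₂ _+₂_ ⟨c,∂χ⟩ ∂x) (1+q+1 q))

      -- Both premises are in the previous stage: `x` is off the new boundary, so altering `c` there
      -- keeps the parity, and `x ∈ I` keeps the support in `J`.
      remove : ∀ {P x Γ} → x ∉ P → (∀ {e} → e ∈ P → Shared e) → Shared x → Stage P Γ → Proof 3 Φ Γ →
               Within (exp₂ (length J) * 1) Γ (Stage (x ∷ P))
      remove {P} {x} {Γ} x∉P P⇒shared (∂x , ∂ᵛx) st π =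
        Family-build (∂′⇒Joint (x ∷ P) λ { (here refl) → ∂x , ∂ᵛx ; (there e∈) → P⇒shared e∈ }) π one
        where
        ⇒joint : ∀ y → y ≢ x → Joint P y → Joint (x ∷ P) y
        ⇒joint y y≢x (E , y∉) = E , λ { (here refl) → y≢x refl ; (there y∈) → y∉ y∈ }

        x∈J : x ∈ J
        x∈J = ∈-++⁺ˡ (shared⇒I (∂x , ∂ᵛx))

        one : ∀ {Γ′} → Γ ⊆ Γ′ → Proof 3 Φ Γ′ → ∀ c → Supported (Joint (x ∷ P)) c J → ⟨ c , ∂ χ′ ⟩ ≡ 1ℙ +₂ q →
              Within 1 Γ′ (Has χ′ (Joint (x ∷ P)) c)
        one Γ⊆ π c supp even = Has-resolve (Has-mono Γ⊆ (st c supp₀ even)) (Has-mono Γ⊆ (st (c ⊕ δ x) supp₁ even₁))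
          (inj₁ ∂x , x∉P) (inj₁ ∂x , x∉P)
          (λ { y (E , y∉) → y∉ ∘ here , inj₁ (E , y∉ ∘ there) })
          (λ y y≢x → ⇒joint y y≢x ∘ [ id , id ]′) π
          where
          supp₀ : Supported (Joint P) c J
          supp₀ e Je ce with e ≟ᵉ x
          ... | yes refl = x∈J
          ... | no  e≢x  = supp e (⇒joint e e≢x Je) ce

          supp₁ : Supported (Joint P) (c ⊕ δ x) J
          supp₁ e Je ce with x ≟ᵉ e
          ... | yes refl = x∈J
          ... | no  x≢e  = supp e (⇒joint e (x≢e ∘ sym) Je) (trans (sym (ℙ.+-identityʳ (c e))) ce)

          even₁ : ⟨ c ⊕ δ x , ∂ χ′ ⟩ ≡ 1ℙ +₂ q
          even₁ = trans (⟨c⊕δ,⟩ c x _)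
            (trans (cong (⟨ c , ∂ χ′ ⟩ +₂_) (Shared⇒∂′ (∂x , ∂ᵛx))) (trans (ℙ.+-identityʳ _) even))

      removeAll : ∀ {P Γ} ys → (∀ {e} → e ∈ ys → Shared e) → (∀ {e} → e ∈ P → Shared e) → Stage P Γ → Proof 3 Φ Γ →
                  Within (length ys * (exp₂ (length J) * 1)) Γ
                    (λ Γ′ → ∃[ P′ ] (∀ {e} → e ∈ P′ → Shared e) × P ⊆ P′ × ys ⊆ P′ × Stage P′ Γ′)
      removeAll {P} [] _ P⇒shared st π = done π (P , P⇒shared , id , (λ ()) , st)
      -- `remove` needs a fresh edge, but the edge that opened the stage recurs among the shared
      -- edges.
      removeAll {P} (y ∷ ys) ys⇒shared P⇒shared st π with y ∈? P
      ... | yes y∈P = relax (ℕ.m≤n+m _ _) (mapResult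
        (λ (P′ , P′⇒shared , P⊆ , ys⊆ , st) →
          P′ , P′⇒shared , P⊆ , (λ { (here refl) → P⊆ y∈P ; (there e∈) → ys⊆ e∈ }) , st)
        (removeAll ys (ys⇒shared ∘ there) P⇒shared st π))
      ... | no y∉P = remove y∉P P⇒shared (ys⇒shared (here refl)) st π >>= λ _ π st → mapResult
        (λ (P′ , P′⇒shared , P⊆ , ys⊆ , st) →
          P′ , P′⇒shared , P⊆ ∘ there , (λ { (here refl) → P⊆ (here refl) ; (there e∈) → ys⊆ e∈ }) , st)
        (removeAll ys (ys⇒shared ∘ there) (λ { (here refl) → ys⇒shared (here refl) ; (there e∈) → P⇒shared e∈ }) st π)

      addCost : ℕ
      addCost = exp₂ (length J) * 2 + length N * (exp₂ (length J) * 1)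

      -- One shared edge merges the equations of `χ` and `v`; the remaining ones, at most
      -- `length N`, are then resolved away one by one.
      add : ∀ {x Γ} → Shared x → State χ I q Γ → Proof 3 Φ Γ → Within addCost Γ (State χ′ J (1ℙ +₂ q))
      add {x} sharedx st π = open-stage sharedx st π >>= λ _ π st →
        relax (ℕ.*-monoˡ-≤ (exp₂ (length J) * 1) (length-filter shared? N)) (mapResult
          (λ (P , P⇒shared , _ , ys⊆ , st) → close P P⇒shared (λ sh → ys⊆ (∈-filter⁺ shared? (∂⇒N (proj₂ sh)) sh)) st)
          (removeAll (filter shared? N) (proj₂ ∘ ∈-filter⁻ shared? {xs = N}) (λ { (here refl) → sharedx }) st π))
        where
        shared? : ∀ e → Dec (Shared e)
        shared? e = (∂ χ e ℙ.≟ 1ℙ) ×-dec (∂ (δᵛ v) e ℙ.≟ 1ℙ)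

        close : ∀ {Γ} P → (∀ {e} → e ∈ P → Shared e) → (∀ {e} → Shared e → e ∈ P) → Stage P Γ → State χ′ J (1ℙ +₂ q) Γ
        close P P⇒shared shared⇒P st c supp even =
          Has-resp (λ _ → id) (Joint⇒∂′ P shared⇒P) (∂′⇒Joint P P⇒shared) (λ _ _ → refl)
            (st c (λ e Je → supp e (Joint⇒∂′ P shared⇒P e Je)) even)

  -- The ends of a sweep.

  State-empty : ∀ {I Γ} → State (λ _ → 0ℙ) I 1ℙ Γ
  -- Vacuous: the empty sum of equations is never violated.
  State-empty c _ odd with () ← trans (sym odd) (trans (⟨⟩-cong {c} {λ _ → 0ℙ} (λ _ ()) (λ _ → refl)) (∑-zero edges))

  -- The first vertex shares no edge with the empty region, so its clauses enter directly as inputs.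
  State-singleton : ∀ v I {Γ} → Proof 3 Φ Γ → Within (exp₂ (length I) * 1) Γ (State (δᵛ v) I 0ℙ)
  State-singleton v I π = Family-build (λ _ → id) π λ _ π c _ even → Has-input (δᵛ-refl v) even π

  -- The set of all vertices has no boundary, so the zero assignment, of parity 0, is excluded by
  -- the clause without literals.
  State-full : ∀ {I Γ} → State (λ _ → 1ℙ) I 0ℙ Γ → Proof 3 Φ Γ → ∃[ s ] HasRefutation 3 Φ s × s ≤ length Γ
  State-full st π with has {A} l exc _ ← st (λ _ → 0ℙ) (λ _ _ ()) (∑-zero edges) = refute A l exc
    where
    refute : ∀ A {Bs} → (A from Bs) ∈ _ → Excludes A (Boundary (λ _ → 1ℙ)) (λ _ → 0ℙ) →
             ∃[ s ] HasRefutation 3 Φ s × s ≤ _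
    refute (_ ∷ _) l exc with _ , () , _ ← exc .sound (here refl)
    refute [] l exc with Δ , π′ , len ← proof-of π l = _ , (_ , Δ , π′ , refl) , len

-- Directions and cyclic successors on the torus.

_≟ᵈ_ : DecidableEquality Direction
i-step ≟ᵈ i-step = yes refl
i-step ≟ᵈ j-step = no λ ()
j-step ≟ᵈ i-step = no λ ()
j-step ≟ᵈ j-step = yes refl

module Cyclic (m : ℕ) where

  last : Fin (suc m)
  last = fromℕ m

  prev : Fin (suc m) → Fin (suc m)
  prev zero    = last
  prev (suc i) = inject₁ i

  next-inject₁ : (i : Fin m) → next (inject₁ i) ≡ suc i
  next-inject₁ i = Fin.toℕ-injective (trans (Fin.toℕ-fromℕ< _)
    (trans (m<n⇒m%n≡m (s≤s (Fin.inject₁ℕ< i))) (cong suc (Fin.toℕ-inject₁ i))))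

  next-last : next last ≡ zero
  next-last = Fin.toℕ-injective (trans (Fin.toℕ-fromℕ< _)
    (trans (cong (λ k → suc k % suc m) (Fin.toℕ-fromℕ m)) (n%n≡0 (suc m))))

  next-prev : (i : Fin (suc m)) → next (prev i) ≡ i
  next-prev zero    = next-last
  next-prev (suc i) = next-inject₁ i

  prev-next : (i : Fin (suc m)) → prev (next i) ≡ i
  prev-next i with view i
  ... | ‵fromℕ     = cong prev next-last
  ... | ‵inject₁ i = cong prev (next-inject₁ i)

  next<⇒last : (i : Fin (suc m)) → toℕ (next i) < toℕ i → i ≡ last
  next<⇒last i lt with view i
  ... | ‵fromℕ     = refl
  ... | ‵inject₁ i = contradiction
    (subst (suc (toℕ i) <_) (Fin.toℕ-inject₁ i)
      (subst (_< toℕ (inject₁ i)) (cong toℕ (next-inject₁ i)) lt))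
    (ℕ.<⇒≯ ℕ.≤-refl)

  last≢zero : 1 ≤ m → last ≢ zero
  last≢zero (s≤s _) ()

  i≢next : 1 ≤ m → (i : Fin (suc m)) → i ≢ next i
  i≢next 1≤m i eq with view i
  ... | ‵fromℕ     = last≢zero 1≤m (trans eq next-last)
  ... | ‵inject₁ i = ℕ.1+n≢n (trans (cong toℕ (trans (sym (next-inject₁ i)) (sym eq))) (Fin.toℕ-inject₁ i))

-- Every step works with at most 12 boundary edges, hence with at most 2 ^ 12 assignments at a time.
addCost extendCost stepCost : ℕ
addCost    = exp₂ 12 * 2 + 4 * (exp₂ 12 * 1)
extendCost = exp₂ 7 * 1 + exp₂ 8 * 1
stepCost   = extendCost + addCost

-- Sweeping the torus.

module Sweep (m : ℕ) (1≤m : 1 ≤ m) where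
  open Cyclic m

  n : ℕ
  n = suc m

  pattern U i j = (i , j) , i-step
  pattern R i j = (i , j) , j-step

  _≟ᵉ_ : DecidableEquality (GridEdge n)
  _≟ᵉ_ = ×-≡-dec (×-≡-dec Fin._≟_ Fin._≟_) _≟ᵈ_

  open Graph (torus n) using (endpoints; _≟ᵛ_)

  loop-free : ∀ e → proj₁ (endpoints e) ≢ proj₂ (endpoints e)
  loop-free (U i j) eq = i≢next 1≤m i (cong proj₁ eq)
  loop-free (R i j) eq = i≢next 1≤m j (cong proj₂ eq)

  open Regions (torus n) _≟ᵉ_ loop-free
  open Derivations 3 Φ
  open Indicator _≟ᵛ_

  around : GridVertex n → List (GridEdge n)
  around (i , j) = U i j ∷ R i j ∷ U (prev i) j ∷ R i (prev j) ∷ []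

  around⇒∂ : ∀ {v e} → e ∈ around v → ∂ (δ v) e ≡ 1ℙ
  around⇒∂ {e = e} (here refl)                         = incident⇒∂ e (inj₁ refl)
  around⇒∂ {e = e} (there (here refl))                 = incident⇒∂ e (inj₁ refl)
  around⇒∂ {i , j} {e} (there (there (here refl)))         = incident⇒∂ e (inj₂ (cong (_, j) (next-prev i)))
  around⇒∂ {i , j} {e} (there (there (there (here refl)))) = incident⇒∂ e (inj₂ (cong (i ,_) (next-prev j)))

  ∂⇒around : ∀ {v e} → ∂ (δ v) e ≡ 1ℙ → e ∈ around v
  ∂⇒around {v} {e} ∂e = incident⇒around e (∂⇒incident e ∂e)
    where
    open Graph (torus n) using (_∋ᵛ_)
    incident⇒around : ∀ e → e ∋ᵛ v → e ∈ around v
    incident⇒around (U i j) (inj₁ refl) = here refl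
    incident⇒around (R i j) (inj₁ refl) = there (here refl)
    incident⇒around (U i j) (inj₂ refl) = there (there (here (cong (λ i → U i j) (sym (prev-next i)))))
    incident⇒around (R i j) (inj₂ refl) = there (there (there (here (cong (λ j → R i j) (sym (prev-next j))))))

  -- Row-major order of the vertices.

  index : GridVertex n → ℕ
  index (i , j) = toℕ i * n + toℕ j

  index-row : ∀ {i i′} j j′ → toℕ i < toℕ i′ → index (i , j) < index (i′ , j′)
  index-row {i} {i′} j j′ i<i′ = begin-strict
    toℕ i * n + toℕ j    <⟨ ℕ.+-monoʳ-< (toℕ i * n) (Fin.toℕ<n j) ⟩
    toℕ i * n + n        ≡⟨ ℕ.+-comm (toℕ i * n) n ⟩
    suc (toℕ i) * n        ≤⟨ ℕ.*-monoˡ-≤ n i<i′ ⟩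
    toℕ i′ * n             ≤⟨ ℕ.m≤m+n _ _ ⟩
    toℕ i′ * n + toℕ j′  ∎
    where open ℕ.≤-Reasoning

  index-mono : ∀ {i i′ j j′} → toℕ i ≤ toℕ i′ → toℕ j ≤ toℕ j′ → index (i , j) ≤ index (i′ , j′)
  index-mono i≤i′ j≤j′ = ℕ.+-mono-≤ (ℕ.*-monoˡ-≤ n i≤i′) j≤j′

  index-injective : ∀ {v w} → index v ≡ index w → v ≡ w
  index-injective {i , j} {i′ , j′} eq with ℕ.<-cmp (toℕ i) (toℕ i′)
  ... | tri< i<i′ _ _ = contradiction eq (ℕ.<⇒≢ (index-row j j′ i<i′))
  ... | tri> _ _ i>i′ = contradiction (sym eq) (ℕ.<⇒≢ (index-row j′ j i>i′))
  ... | tri≈ _ i≡i′ _ with refl ← Fin.toℕ-injective i≡i′ =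
    cong (i ,_) (Fin.toℕ-injective (ℕ.+-cancelˡ-≡ (toℕ i * n) _ _ eq))

  index<n² : ∀ v → index v < n * n
  index<n² (i , j) = begin-strict
    toℕ i * n + toℕ j  <⟨ ℕ.+-monoʳ-< (toℕ i * n) (Fin.toℕ<n j) ⟩
    toℕ i * n + n      ≡⟨ ℕ.+-comm (toℕ i * n) n ⟩
    suc (toℕ i) * n      ≤⟨ ℕ.*-monoˡ-≤ n (Fin.toℕ<n i) ⟩
    n * n                ∎
    where open ℕ.≤-Reasoning

  index-next-column : ∀ i j → index (i , suc j) ≡ suc (index (i , inject₁ j))
  index-next-column i j = trans (ℕ.+-suc (toℕ i * n) (toℕ j))
    (cong (λ k → suc (toℕ i * n + k)) (sym (Fin.toℕ-inject₁ j)))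

  index-next-row : ∀ i → index (suc i , zero) ≡ suc (index (inject₁ i , last))
  index-next-row i rewrite Fin.toℕ-inject₁ i | Fin.toℕ-fromℕ m =
    cong suc (trans (ℕ.+-identityʳ _) (ℕ.+-comm m (toℕ i * n)))

  index-end : suc (index (last , last)) ≡ n * n
  index-end rewrite Fin.toℕ-fromℕ m = cong suc (ℕ.+-comm (m * n) m)

  -- Initial segments of the sweep.

  opaque
    below : ℕ → GridVertex n → Parity
    below t v with index v ℕ.<? t
    ... | yes _ = 1ℙ
    ... | no  _ = 0ℙ

    below-< : ∀ {t v} → index v < t → below t v ≡ 1ℙ
    below-< {t} {v} lt with index v ℕ.<? t
    ... | yes _  = refl
    ... | no ¬lt = contradiction lt ¬lt

    below-≥ : ∀ {t v} → t ≤ index v → below t v ≡ 0ℙ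
    below-≥ {t} {v} ge with index v ℕ.<? t
    ... | yes lt = contradiction lt (ℕ.≤⇒≯ ge)
    ... | no _   = refl

    below≡1⇒< : ∀ {t v} → below t v ≡ 1ℙ → index v < t
    below≡1⇒< {t} {v} eq with index v ℕ.<? t
    ... | yes lt = lt
    below≡1⇒< () | no _

  below-suc : ∀ v → below (index v) ⊕ δ v ≗ below (suc (index v))
  below-suc v w with ℕ.<-cmp (index w) (index v)
  ... | tri< lt w≢v _ =
    trans (cong₂ _+₂_ (below-< {v = w} lt) (δ-≢ {v} {w} (w≢v ∘ cong index ∘ sym)))
          (sym (below-< {v = w} (ℕ.m<n⇒m<1+n lt)))
  ... | tri> _ w≢v gt =
    trans (cong₂ _+₂_ (below-≥ {v = w} (ℕ.<⇒≤ gt)) (δ-≢ {v} {w} (w≢v ∘ cong index ∘ sym)))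
          (sym (below-≥ {v = w} gt))
  ... | tri≈ _ eq _ with refl ← index-injective {w} {v} eq =
    trans (cong₂ _+₂_ (below-≥ {v = v} ℕ.≤-refl) (δ-refl v)) (sym (below-< {v = v} ℕ.≤-refl))

  boundary⇒below : ∀ {χ : GridVertex n → Parity} e → ∂ χ e ≡ 1ℙ →
                   χ (proj₁ (endpoints e)) ≡ 0ℙ → χ (proj₂ (endpoints e)) ≡ 1ℙ
  boundary⇒below e ∂e χ₁ rewrite χ₁ = ∂e

  -- The first two edges lead to the neighbours above and to the left; `R i last` closes the row and
  -- `U last j` the column. `U i zero` and `U last zero` are stored for the first vertex of the next
  -- row.
  interface : GridVertex n → List (GridEdge n)
  interface (i , j) = U (prev i) j ∷ R i (prev j) ∷ R i last ∷ U last j ∷ U i zero ∷ U last zero ∷ []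

  -- The edges leaving v in the directions of the sweep reach vertices already swept only by wrapping around.
  shared⇒interface : ∀ v {e} → ∂ (below (index v)) e ≡ 1ℙ → ∂ (δ v) e ≡ 1ℙ → e ∈ interface v
  shared⇒interface (i , j) {e} ∂e ∂ᵛe with ∂⇒around {i , j} {e} ∂ᵛe
  ... | here refl = there (there (there (here (cong (λ i → U i j) (next<⇒last i
          (ℕ.*-cancelʳ-< n _ _ (ℕ.+-cancelʳ-< (toℕ j) _ _ swept)))))))
    where
    swept : index (next i , j) < index (i , j)
    swept = below≡1⇒< {v = next i , j}
      (boundary⇒below {below (index (i , j))} (U i j) ∂e (below-≥ {v = i , j} ℕ.≤-refl))
  ... | there (here refl) = there (there (here (cong (λ j → R i j) (next<⇒last j
          (ℕ.+-cancelˡ-< (toℕ i * n) _ _ swept)))))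
    where
    swept : index (i , next j) < index (i , j)
    swept = below≡1⇒< {v = i , next j}
      (boundary⇒below {below (index (i , j))} (R i j) ∂e (below-≥ {v = i , j} ℕ.≤-refl))
  ... | there (there (here refl)) = here refl
  ... | there (there (there (here refl))) = there (here refl)

  -- The sum of `t` equations has right-hand side `parity t`; this is the opposite, violating
  -- parity.
  charge : ℕ → Parity
  charge t = parity (suc t)

  charge-suc : ∀ t → 1ℙ +₂ charge t ≡ charge (suc t)
  charge-suc = ℙ.suc-homo-⁻¹

  Reached : GridVertex n → List (Line (GridEdge n)) → Set
  Reached v = State (below (index v)) (interface v) (charge (index v))

  AddResult : GridVertex n → GridEdge n → GridEdge n → List (Line (GridEdge n)) → Set
  AddResult v e f = State (below (suc (index v))) ((e ∷ f ∷ interface v) ++ around v) (charge (suc (index v)))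

  add-shared : ∀ v e f {x Γ} → ∂ (below (index v)) x ≡ 1ℙ → ∂ (δ v) x ≡ 1ℙ →
               State (below (index v)) (e ∷ f ∷ interface v) (charge (index v)) Γ → Proof 3 Φ Γ →
               Within addCost Γ (AddResult v e f)
  add-shared v e f {x} ∂x ∂ᵛx st π =
    mapResult (λ {Γ} → subst (λ q → State (below (suc (index v))) ((e ∷ f ∷ interface v) ++ around v) q Γ)
                        (charge-suc (index v)) ∘
               State-weaken {below (index v) ⊕ δ v} {below (suc (index v))} (below-suc v) (λ _ _ → id))
      (AddVertex.add (below (index v)) v (below-≥ {v = v} ℕ.≤-refl) (e ∷ f ∷ interface v) (around v)
        around⇒∂ ∂⇒around (charge (index v))
        (λ {y} sh → there (there (shared⇒interface v {y} (proj₁ sh) (proj₂ sh)))) {x} (∂x , ∂ᵛx) st π)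

  -- The edge to resolve on comes from the left neighbour, or from the upper one in the first
  -- column. The very first vertex has neither. The lists have 2 + 6 + 4 = 12 edges.
  add-vertex : ∀ v e f {Γ} → State (below (index v)) (e ∷ f ∷ interface v) (charge (index v)) Γ → Proof 3 Φ Γ →
               Within addCost Γ (AddResult v e f)
  add-vertex (i , suc j) e f st π = add-shared (i , suc j) e f {R i (inject₁ j)}
    (cong₂ _+₂_ (below-< {v = i , inject₁ j} (ℕ.≤-reflexive (sym (index-next-column i j))))
               (trans (cong (λ j′ → below (index (i , suc j)) (i , j′)) (next-inject₁ j))
                      (below-≥ {v = i , suc j} ℕ.≤-refl)))
    (around⇒∂ {i , suc j} {R i (inject₁ j)} (there (there (there (here refl))))) st π
  add-vertex (suc i , zero) e f st π = add-shared (suc i , zero) e f {U (inject₁ i) zero}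
    (cong₂ _+₂_ (below-< {v = inject₁ i , zero} (index-row zero zero (s≤s (ℕ.≤-reflexive (Fin.toℕ-inject₁ i)))))
               (trans (cong (λ i′ → below (index (suc i , zero)) (i′ , zero)) (next-inject₁ i))
                      (below-≥ {v = suc i , zero} ℕ.≤-refl)))
    (around⇒∂ {suc i , zero} {U (inject₁ i) zero} (there (there (here refl)))) st π
  add-vertex (zero , zero) e f st π = relax
    (ℕ.≤-trans (ℕ.*-monoʳ-≤ (exp₂ 12) (s≤s z≤n)) (ℕ.m≤m+n (exp₂ 12 * 2) _))
    (mapResult (State-weaken {δ (zero , zero)}
      (λ w → trans (cong (_+₂ δ (zero , zero) w) (sym (below-≥ {0} {w} z≤n))) (below-suc (zero , zero) w))
      (λ _ _ → id))
    (State-singleton (zero , zero) ((e ∷ f ∷ interface (zero , zero)) ++ around (zero , zero)) π))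

  -- Done before the vertex is added, while its edges above and around the column are still on the
  -- boundary. The 6 edges of the interface grow to 7 and then 8.
  extend-right : ∀ i j {Γ} → Reached (i , inject₁ j) Γ → Proof 3 Φ Γ →
    Within extendCost Γ (State (below (index (i , inject₁ j)))
      (U last (suc j) ∷ U (prev i) (suc j) ∷ interface (i , inject₁ j)) (charge (index (i , inject₁ j))))
  -- In row 0 both requested edges are `U last (suc j)`, which joins two unswept vertices.
  extend-right zero j st π = done π (State-weaken {χ = below _} (λ _ → refl) interior st)
    where
    v : GridVertex n
    v = zero , inject₁ j

    outside : ∀ i → below (index v) (i , suc j) ≡ 0ℙ
    outside i = below-≥ {v = i , suc j} (index-mono {zero} {i} {inject₁ j} {suc j} z≤n
      (ℕ.≤-trans (ℕ.≤-reflexive (Fin.toℕ-inject₁ j)) (ℕ.n≤1+n _)))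

    not-boundary : ∂ (below (index v)) (U last (suc j)) ≢ 1ℙ
    not-boundary ∂e with () ← trans (sym ∂e) (cong₂ _+₂_ (outside last) (outside (next last)))

    interior : ∀ e → ∂ (below (index v)) e ≡ 1ℙ → e ∈ U last (suc j) ∷ U last (suc j) ∷ interface v → e ∈ interface v
    interior e ∂e (here refl)         = contradiction ∂e not-boundary
    interior e ∂e (there (here refl)) = contradiction ∂e not-boundary
    interior e ∂e (there (there e∈))  = e∈
  extend-right (suc i) j {Γ} st π =
    -- This path runs through the row above the current one; the next one runs through row 0 and has
    -- its ends in the last row.
    State-extend {χ} (inject₁ i , inject₁ j) (suc i , inject₁ j) (inject₁ i , suc j) (suc i , suc j)
      {U (inject₁ i) (inject₁ j)} {R (inject₁ i) (inject₁ j)} {U (inject₁ i) (suc j)}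
      (above (inject₁ j)) (at-or-after ℕ.≤-refl ℕ.≤-refl) (above (suc j)) (at-or-after ℕ.≤-refl right)
      (λ ψ → cong (λ i′ → ψ (inject₁ i , inject₁ j) +₂ ψ (i′ , inject₁ j)) (next-inject₁ i))
      (λ ψ → cong (λ j′ → ψ (inject₁ i , inject₁ j) +₂ ψ (inject₁ i , j′)) (next-inject₁ j))
      (λ ψ → cong (λ i′ → ψ (inject₁ i , suc j) +₂ ψ (i′ , suc j)) (next-inject₁ i))
      (here refl) st π
    >>= λ _ π st →
    State-extend {χ} (zero , inject₁ j) (last , inject₁ j) (zero , suc j) (last , suc j)
      {U last (inject₁ j)} {R zero (inject₁ j)} {U last (suc j)}
      (below-< {v = zero , inject₁ j} (index-row {zero} {suc i} (inject₁ j) (inject₁ j) (s≤s z≤n)))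
      (at-or-after {last} (Fin.≤fromℕ (suc i)) ℕ.≤-refl)
      (below-< {v = zero , suc j} (index-row {zero} {suc i} (suc j) (inject₁ j) (s≤s z≤n)))
      (at-or-after {last} (Fin.≤fromℕ (suc i)) right)
      (λ ψ → trans (cong (λ i′ → ψ (last , inject₁ j) +₂ ψ (i′ , inject₁ j)) next-last)
                   (ℙ.+-comm (ψ (last , inject₁ j)) _))
      (λ ψ → cong (λ j′ → ψ (zero , inject₁ j) +₂ ψ (zero , j′)) (next-inject₁ j))
      (λ ψ → trans (cong (λ i′ → ψ (last , suc j) +₂ ψ (i′ , suc j)) next-last)
                   (ℙ.+-comm (ψ (last , suc j)) _))
      (there (there (there (there (here refl))))) st π
    where
    χ : GridVertex n → Parity
    χ = below (index (suc i , inject₁ j))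

    above : ∀ j′ → χ (inject₁ i , j′) ≡ 1ℙ
    above j′ = below-< {v = inject₁ i , j′} (index-row j′ (inject₁ j) (s≤s (ℕ.≤-reflexive (Fin.toℕ-inject₁ i))))

    at-or-after : ∀ {i′ j′} → toℕ (suc i) ≤ toℕ i′ → toℕ (inject₁ j) ≤ toℕ j′ → χ (i′ , j′) ≡ 0ℙ
    at-or-after {i′} {j′} i≤ j≤ = below-≥ {v = i′ , j′} (index-mono {suc i} {i′} {inject₁ j} {j′} i≤ j≤)

    right : toℕ (inject₁ j) ≤ toℕ (suc j)
    right = ℕ.≤-trans (ℕ.≤-reflexive (Fin.toℕ-inject₁ j)) (ℕ.n≤1+n _)

  next-column : ∀ i j {Γ} → Reached (i , inject₁ j) Γ → Proof 3 Φ Γ → Within stepCost Γ (Reached (i , suc j))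
  next-column i j st π = extend-right i j st π >>= λ _ π st →
    mapResult (λ {Γ} → subst (λ t → State (below t) (interface (i , suc j)) (charge t) Γ)
                        (sym (index-next-column i j)) ∘
               State-weaken {χ = below _} (λ _ → refl) (λ _ _ → ⊆-after))
      (add-vertex (i , inject₁ j) (U last (suc j)) (U (prev i) (suc j)) st π)
    where
    -- The left edge comes from the vertex just added, the two vertical edges of the new column from
    -- the extension, and the other three are kept.
    ⊆-after : interface (i , suc j) ⊆
              (U last (suc j) ∷ U (prev i) (suc j) ∷ interface (i , inject₁ j)) ++ around (i , inject₁ j)
    ⊆-after (here refl)                                 = there (here refl)
    ⊆-after (there (here refl))                         =
      ∈-++⁺ʳ (U last (suc j) ∷ U (prev i) (suc j) ∷ interface (i , inject₁ j)) (there (here refl))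
    ⊆-after (there (there (here refl)))                 = there (there (there (there (here refl))))
    ⊆-after (there (there (there (here refl))))         = here refl
    ⊆-after (there (there (there (there (here refl))))) = there (there (there (there (there (there (here refl))))))
    ⊆-after (there (there (there (there (there (here refl)))))) =
      there (there (there (there (there (there (there (here refl)))))))

  -- There is no column to the right; padding with `U last zero`, which is already present, keeps
  -- the list at 12 edges.
  row-end : ∀ i {Γ} → Reached (i , last) Γ → Proof 3 Φ Γ →
            Within stepCost Γ (AddResult (i , last) (U last zero) (U last zero))
  row-end i st π = relax (ℕ.m≤n+m addCost extendCost) (add-vertex (i , last) (U last zero) (U last zero)
    (State-weaken {χ = below _} (λ _ → refl)
      (λ _ _ → λ { (here refl) → U∈ ; (there (here refl)) → U∈ ; (there (there e∈)) → e∈ }) st) π)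
    where
    U∈ : U last zero ∈ interface (i , last)
    U∈ = there (there (there (there (there (here refl)))))

  -- Both horizontal edges are `R (suc i) last`, which joins unswept vertices. `U (suc i) zero` is
  -- on the boundary only in the last row, where it is `U last zero`. The rest was stored.
  next-row : ∀ i {Γ} → Reached (inject₁ i , last) Γ → Proof 3 Φ Γ → Within stepCost Γ (Reached (suc i , zero))
  next-row i st π = mapResult
    (λ {Γ} → subst (λ t → State (below t) (interface (suc i , zero)) (charge t) Γ) (sym (index-next-row i)) ∘
             State-weaken {χ = below _} (λ _ → refl) λ e ∂e →
               boundary e (subst (λ t → ∂ (below t) e ≡ 1ℙ) (sym (index-next-row i)) ∂e))
    (row-end (inject₁ i) st π)
    where
    χ : GridVertex n → Parity
    χ = below (index (suc i , zero))

    after : List (GridEdge n)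
    after = (U last zero ∷ U last zero ∷ interface (inject₁ i , last)) ++ around (inject₁ i , last)

    row-outside : ∀ j → χ (suc i , j) ≡ 0ℙ
    row-outside j = below-≥ {v = suc i , j} (index-mono {suc i} {suc i} {zero} {j} ℕ.≤-refl z≤n)

    not-boundary : ∂ χ (R (suc i) last) ≢ 1ℙ
    not-boundary ∂e with () ← trans (sym ∂e) (cong₂ _+₂_ (row-outside last) (row-outside (next last)))

    wraps : ∂ χ (U (suc i) zero) ≡ 1ℙ → suc i ≡ last
    wraps ∂e = next<⇒last (suc i) (ℕ.*-cancelʳ-< n _ _ (ℕ.+-cancelʳ-< 0 _ _
      (below≡1⇒< {v = next (suc i) , zero} (boundary⇒below {χ} (U (suc i) zero) ∂e (row-outside zero)))))

    boundary : ∀ e → ∂ χ e ≡ 1ℙ → e ∈ interface (suc i , zero) → e ∈ after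
    boundary e ∂e (here refl)                                 = there (there (there (there (there (there (here refl))))))
    boundary e ∂e (there (here refl))                         = contradiction ∂e not-boundary
    boundary e ∂e (there (there (here refl)))                 = contradiction ∂e not-boundary
    boundary e ∂e (there (there (there (here refl))))         = here refl
    boundary e ∂e (there (there (there (there (here refl))))) = here (cong (λ i → U i zero) (wraps ∂e))
    boundary e ∂e (there (there (there (there (there (here refl)))))) = here refl

  -- Counting the lines of the whole sweep.

  ReachedFast : GridVertex n → Set
  ReachedFast v = Within (index v * stepCost) [] (Reached v)

  advance : ∀ {v w} → index w ≡ suc (index v) →
            (∀ {Γ} → Reached v Γ → Proof 3 Φ Γ → Within stepCost Γ (Reached w)) → ReachedFast v → ReachedFast w
  advance {v} eq move fast = relax
    (ℕ.≤-reflexive (trans (ℕ.+-comm (index v * stepCost) stepCost) (cong (_* stepCost) (sym eq))))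
    (fast >>= λ _ π st → move st π)

  along-row : ∀ i → ReachedFast (i , zero) → ∀ j → ReachedFast (i , j)
  along-row i start = <-weakInduction (λ j → ReachedFast (i , j)) start
    λ j → advance (index-next-column i j) (next-column i j)

  reached : ∀ i j → ReachedFast (i , j)
  reached i = along-row i (<-weakInduction (λ i → ReachedFast (i , zero)) start
    (λ i fast → advance (index-next-row i) (next-row i) (along-row (inject₁ i) fast last)) i)
    where
    start : ReachedFast (zero , zero)
    start = done [] (State-weaken (λ w → sym (below-≥ {v = w} z≤n)) (λ _ _ → id)
      (State-empty {interface (zero , zero)}))

  -- For odd `n` the number of vertices is odd, so the final violating parity is 0 and the empty
  -- clause has been derived.
  refutation : parity n ≡ 1ℙ → ∃[ s ] HasRefutation 3 Φ s × s ≤ n * n * stepCost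
  refutation odd = conclude (reached last last >>= λ _ π st → row-end last st π)
    where
    after : List (GridEdge n)
    after = (U last zero ∷ U last zero ∷ interface (last , last)) ++ around (last , last)

    full : ∀ w → below (suc (index (last , last))) w ≡ 1ℙ
    full w = below-< {v = w} (subst (index w <_) (sym index-end) (index<n² w))

    even : charge (suc (index (last , last))) ≡ 0ℙ
    even = trans (cong charge index-end) (trans (sym (charge-suc′ (n * n)))
      (cong _⁻¹ (trans (ℙ.*-homo-* n n) (cong₂ _*₂_ odd odd))))
      where
      charge-suc′ : ∀ t → (parity t) ⁻¹ ≡ charge t
      charge-suc′ t = trans (cong _⁻¹ (sym (ℙ.suc-homo-⁻¹ t))) (ℙ.⁻¹-involutive _)

    conclude : Within (index (last , last) * stepCost + stepCost) []
                 (AddResult (last , last) (U last zero) (U last zero)) →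
               ∃[ s ] HasRefutation 3 Φ s × s ≤ n * n * stepCost
    conclude (within π _ cost st)
      with s , r , s≤ ← State-full (State-weaken {below _} full (λ _ _ → id)
        (subst (λ q → State (below (suc (index (last , last)))) after q _) even st)) π =
      s , r , ℕ.≤-trans s≤ (ℕ.≤-trans cost (ℕ.≤-reflexive (trans (ℕ.+-identityʳ _)
        (trans (ℕ.+-comm (index (last , last) * stepCost) stepCost) (cong (_* stepCost) index-end)))))

-- The bound for shortest proofs.

odd⇒parity≡1 : ∀ n → n % 2 ≡ 1 → parity n ≡ 1ℙ
odd⇒parity≡1 (suc zero)    _   = refl
odd⇒parity≡1 (suc (suc n)) odd = odd⇒parity≡1 n odd

theorem23 : ∃[ C ] ∃[ N ] ((n : ℕ) → 3 ≤ n → n % 2 ≡ 1 → N ≤ n →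
    ∃[ s ] ((S[ 3 -SRC-II] T n ≔ s) × s ≤ C * n ^ 2))
-- The constant is the cost per vertex, and the bound holds from the smallest torus on.
theorem23 = stepCost , 0 , shortest
  where
  shortest : (n : ℕ) → 3 ≤ n → n % 2 ≡ 1 → 0 ≤ n → ∃[ s ] ((S[ 3 -SRC-II] T n ≔ s) × s ≤ stepCost * n ^ 2)
  shortest n@(suc m) (s≤s 2≤m) odd _ =
    -- The sweep supplies some refutation; decidability for each length then yields a shortest one,
    -- no longer than it.
    let s , r , s≤ = Sweep.refutation m 1≤m (odd⇒parity≡1 n odd)
        s′ , isLeast , s′≤s = least (hasRefutation? 3 (T n)) r
    in s′ , isLeast , ℕ.≤-trans s′≤s (ℕ.≤-trans s≤ (ℕ.≤-reflexive bound))
    where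
    1≤m : 1 ≤ m
    1≤m = ℕ.≤-trans (s≤s z≤n) 2≤m

    bound : n * n * stepCost ≡ stepCost * n ^ 2
    bound = trans (ℕ.*-comm (n * n) stepCost) (cong (λ k → stepCost * (n * k)) (sym (ℕ.*-identityʳ n)))

    open FiniteVariables (Sweep._≟ᵉ_ m 1≤m) (Graph.edges (torus n)) (Graph.edges-complete (torus n))
      using (hasRefutation?)
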